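{- Let $\lambda$ be a partition of $n$ with at most three rows or at most two columns. Suppose $w\in S_n$ is a Schubert point associated to $\lambda$ and $v\in S_n$ satisfies $v\le w$ in Bruhat order. Then $v$ is also a Schubert point associated to $\lambda$.
   Context: $S_n$ is generated by the simple transpositions $s_i=(i,i+1)$, $1\le i\le n-1$; $\le$ denotes Bruhat order. A partition $\lambda=(\lambda_1\ge\lambda_2\ge\cdots)$ of $n$ is drawn as a left-justified Young diagram whose $i$-th row from the top has $\lambda_i$ boxes. A row-strict tableau of shape $\lambda$ is a filling of the boxes by $1,\dots,n$, each used once, with entries increasing left to right in each row (no condition on columns). For a row-strict tableau $T$, a Springer dimension pair is a pair $(p,q)$ with $1\le p<q\le n$ such that (1) $q$ occurs in a box below $p$ in the same column, or in any column strictly to the left of $p$; and (2) if the box directly to the right of $p$ exists and is filled by $r_p$, then $q<r_p$. For $2\le q\le n$ let $\ell_{q-1}$ be the number of Springer dimension pairs of $T$ of the form $(p,q)$. Put $w_{q-1}=s_{q-\ell_{q-1}}s_{q-\ell_{q-1}+1}\cdots s_{q-2}s_{q-1}$ if $\ell_{q-1}\ne0$, and $w_{q-1}=e$ if $\ell_{q-1}=0$. The Schubert point of $T$ is $w_T=w_{n-1}w_{n-2}\cdots w_2w_1\in S_n$. A Schubert point associated to $\lambda$ is a permutation of the form $w_T$ for some row-strict tableau $T$ of shape $\lambda$. -}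

module Defs where

open import Data.Nat.Base as ℕ using (ℕ; zero; suc; _∸_; _≤_; _<_; _≥_)
import Data.Nat.Properties as ℕₚ
open import Data.Fin.Base as Fin using (Fin; zero; suc; toℕ; inject₁)
import Data.Fin.Properties as Finₚ
open import Data.Fin.Permutation using (Permutation′; _≈_; id; transpose; _∘ₚ_)
open import Data.List.Base
  using (List; []; _∷_; length; lookup; sum; filter; allFin; map; foldr; reverse; _∷ʳ_)
open import Data.List.Relation.Unary.All using (All)
open import Data.List.Relation.Unary.Linked using (Linked)
open import Data.Product.Base using (Σ; ∃; ∃₂; _×_; _,_; proj₁; proj₂)
open import Data.Sum.Base using (_⊎_)
open import Function.Bundles using (_↔_; Inverse)
open import Relation.Binary.PropositionalEquality.Core using (_≡_)
open import Relation.Nullary.Decidable using (Dec; _×-dec_; _⊎-dec_; _→-dec_)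

private
  variable
    n : ℕ

-- Fin n models {1,…,n}: the element i is the one with toℕ equal to i ∸ 1.

------------------------------------------------------------------------
-- The symmetric group and its Bruhat order

infixl 7 _·_

-- Products of permutations compose right to left: (σ · τ)(i) = σ(τ(i)),
-- whereas _∘ₚ_ composes left to right.
_·_ : Permutation′ n → Permutation′ n → Permutation′ n
σ · τ = τ ∘ₚ σ

∏ : List (Permutation′ n) → Permutation′ n
∏ = foldr _·_ id

-- The simple transposition s_{i+1} = (i+1, i+2), in 1-based notation, for
-- i = 0, …, n ∸ 2.
s : Fin (n ∸ 1) → Permutation′ n
s {suc _} i = transpose (inject₁ i) (suc i)

Word : ℕ → Set
Word n = List (Fin (n ∸ 1))

⟦_⟧ : Word n → Permutation′ n
⟦ is ⟧ = ∏ (map s is)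

-- k is the Coxeter length of w: the least number of simple transpositions
-- in an expression for w.
record HasLength (w : Permutation′ n) (k : ℕ) : Set where
  field
    attained : ∃ λ (is : Word n) → length is ≡ k × ⟦ is ⟧ ≈ w
    minimal  : ∀ (is : Word n) → ⟦ is ⟧ ≈ w → k ≤ length is

infix 4 _⟶_ _≤ᴮ_

-- Edges of the Bruhat graph: w = u t for a transposition t, with ℓ(u) < ℓ(w).
_⟶_ : Permutation′ n → Permutation′ n → Set
u ⟶ w =
  (∃₂ λ i j → i Fin.< j × w ≈ u · transpose i j) ×
  (∃₂ λ k l → HasLength u k × HasLength w l × k < l)

-- Bruhat order is the reflexive transitive closure of _⟶_.  Reflexivity is
-- stated for pointwise equality _≈_, since stdlib permutations carry inverse
-- proofs and need not be propositionally equal.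
data _≤ᴮ_ {n} : Permutation′ n → Permutation′ n → Set where
  reflexive : ∀ {v w} → v ≈ w → v ≤ᴮ w
  step      : ∀ {v u w} → v ⟶ u → u ≤ᴮ w → v ≤ᴮ w

------------------------------------------------------------------------
-- Partitions and row-strict tableaux

-- Only the nonzero parts are listed.
record Partition (n : ℕ) : Set where
  field
    parts      : List ℕ
    decreasing : Linked _≥_ parts
    positive   : All (0 <_) parts
    total      : sum parts ≡ n

  rows : ℕ
  rows = length parts

  columns : ℕ
  columns with parts
  ... | []     = 0
  ... | m ∷ _  = m

  -- Row r (from the top) has as many boxes as the part at position r.
  Box : Set
  Box = Σ (Fin (length parts)) λ r → Fin (lookup parts r)

record RowStrictTableau (μ : Partition n) : Set where
  open Partition μ
  field
    filling    : Box ↔ Fin n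
    row-strict : ∀ r {c d : Fin (lookup parts r)} → c Fin.< d →
                 Inverse.to filling (r , c) Fin.< Inverse.to filling (r , d)

  entry : Box → Fin n
  entry = Inverse.to filling

  box : Fin n → Box
  box = Inverse.from filling

  row : Fin n → Fin (length parts)
  row p = proj₁ (box p)

  col : Fin n → ℕ
  col p = toℕ (proj₂ (box p))

------------------------------------------------------------------------
-- Springer dimension pairs and Schubert points

module _ {μ : Partition n} (T : RowStrictTableau μ) where
  open Partition μ
  open RowStrictTableau T

  DimensionPair : Fin n → Fin n → Set
  DimensionPair p q =
    p Fin.< q ×
    (col q ≡ col p × row p Fin.< row q ⊎ col q < col p) ×
    (∀ (c : Fin (lookup parts (row p))) → toℕ c ≡ suc (col p) →
       q Fin.< entry (row p , c))

  dimensionPair? : ∀ p q → Dec (DimensionPair p q)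
  dimensionPair? p q =
    (p Finₚ.<? q) ×-dec
    (((col q ℕₚ.≟ col p) ×-dec (row p Finₚ.<? row q)) ⊎-dec (col q ℕₚ.<? col p)) ×-dec
    Finₚ.all? λ c → (toℕ c ℕₚ.≟ suc (col p)) →-dec (q Finₚ.<? entry (row p , c))

  dimensionPairs : Fin n → ℕ
  dimensionPairs q = length (filter (λ p → dimensionPair? p q) (allFin n))

-- The index k : Fin (n ∸ 1), which names the simple transposition s_{q-1} with
-- q = k + 2 in 1-based notation, also names the entry q itself.
upper : Fin (n ∸ 1) → Fin n
upper {suc _} k = suc k

-- descent k ℓ is the word s_{q-ℓ} ⋯ s_{q-2} s_{q-1} of length ℓ, with q as
-- above, provided ℓ ≤ q - 1.  That holds for the number ℓ of dimension pairs
-- (p,q), since p < q; for larger ℓ the indices are truncated at s_1.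
descent : ∀ {m} → Fin m → ℕ → List (Fin m)
descent k zero    = []
descent k (suc ℓ) = descent (Fin.pred k) ℓ ∷ʳ k

factor : {μ : Partition n} → RowStrictTableau μ → Fin (n ∸ 1) → Permutation′ n
factor {n} T k = ⟦_⟧ {n} (descent k (dimensionPairs T (upper {n} k)))

-- w_T = w_{n-1} w_{n-2} ⋯ w_2 w_1
schubertPoint : {μ : Partition n} → RowStrictTableau μ → Permutation′ n
schubertPoint {n} T = ∏ (map (factor T) (reverse (allFin (n ∸ 1))))

IsSchubertPoint : Partition n → Permutation′ n → Set
IsSchubertPoint μ w = ∃ λ (T : RowStrictTableau μ) → w ≈ schubertPoint T

{-# OPTIONS --safe #-}
module Submission where

-- Encode w by its code c_q = #{p < q : w p > w q}. The code of w_T lists the numbers of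
-- dimension pairs of T, and c is the code of a Schubert point exactly when one can remove the
-- boxes of λ one at a time, for q = n, …, 1 from the end of the row that has rank c_q by
-- decreasing length (ties broken from the top). Such removals stay possible if the codes
-- decrease, or if λ is replaced by a smaller shape in dominance order.
--
-- A Bruhat cover swaps an inversion i < j of w that has no intermediate value between its two
-- positions. It lowers c_j, may raise c_i, and keeps the codes in between. Running the two
-- removal processes side by side between j and i, one keeps their column heights close enough
-- that they end in comparable shapes: this works if there are at most two columns, and with
-- three rows the bound c_q ≤ 2 leaves essentially one case.

open import Defs
open import Data.Nat.Base
  using (ℕ; zero; suc; pred; _+_; _∸_; _≤_; _<_; _≥_; z≤n; s≤s; s≤s⁻¹; z<s; >-nonZero)
import Data.Nat.Properties as ℕₚ
open import Data.Nat.Induction using (<-wellFounded)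
open import Data.Fin.Base as Fin using (Fin; zero; suc; toℕ; fromℕ<; inject₁; punchOut)
import Data.Fin.Properties as Finₚ
open import Data.Fin.Permutation as Perm using (Permutation′; _≈_; transpose; flip; _⟨$⟩ʳ_)
open import Data.List.Base
  using (List; []; _∷_; _++_; _∷ʳ_; length; lookup; map; filter; tabulate; allFin; reverse; downFrom)
open import Data.List.Properties
  using (length-++-sucʳ; length-filter; length-tabulate; length-downFrom; filter-accept;
         filter-reject; filter-none; filter-all; unfold-reverse; map-++)
open import Data.List.Membership.Propositional using (_∈_)
open import Data.List.Membership.Propositional.Properties
  using (∈-∃++; ∈-++⁺ˡ; ∈-++⁺ʳ; ∈-++⁻; ∈-filter⁺; ∈-filter⁻; ∈-downFrom⁺; ∈-downFrom⁻; ∈-allFin)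
open import Data.List.Relation.Unary.Any using (here; there)
open import Data.List.Relation.Unary.All as All using ()
open import Data.List.Relation.Unary.AllPairs using ([]; _∷_)
open import Data.List.Relation.Unary.Linked using (Linked; _∷_)
open import Data.List.Relation.Unary.Unique.Propositional using (Unique)
import Data.List.Relation.Unary.Unique.Propositional.Properties as Unique
open import Data.Product.Base using (∃; _×_; _,_; proj₁; proj₂; map₂)
open import Data.Sum.Base using (_⊎_; inj₁; inj₂)
open import Data.Unit.Base using (⊤; tt)
open import Data.Vec.Functional using (updateAt)
open import Data.Vec.Functional.Properties using (updateAt-updates; updateAt-minimal)
open import Function.Base using (_∘_; id)
open import Function.Bundles using (Inverse; mk↔ₛ′)
open import Function.Definitions using (Injective)
open import Induction.WellFounded as WF using (Acc)
open import Level using (0ℓ)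
open import Relation.Binary.Definitions using (tri<; tri≈; tri>)
open import Relation.Binary.PropositionalEquality
open import Relation.Nullary using (¬_; Dec; yes; no; contradiction)
open import Relation.Nullary.Decidable using (¬?; _×-dec_; _⊎-dec_)
open import Relation.Unary using (Pred; Decidable)

-- Lowering an index moves the removed box weakly to the right, so the partial sums of column
-- heights stay at least as large. Their first term is the number of nonempty rows, and an index is
-- usable exactly when it lies below that number. Hence dominance, read off column heights, is the
-- order that monotonicity respects. The obstacle is position `i`, where the rise of the code is not
-- absorbed by monotonicity. Removals go from the last position down, so the decrease at `j` comes
-- first and gives the second process a head start, which has to survive until `i`. The invariants
-- record what this head start looks like on the way. Edges of the Bruhat graph are arbitrary
-- transpositions compared by length. Each is turned into an undone inversion by the exchange
-- property, and then factored until only covers remain.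

private
  variable
    n : ℕ

-- Counting

♯ : {A : Set} {P : Pred A 0ℓ} → Decidable P → List A → ℕ
♯ P? xs = length (filter P? xs)

-- Induction deletes the partner of the head from `ys`. The matching is a relation, so it can be
-- given by cases or by preimages, and only on members of `xs`.
unique-length-≤ : {A B : Set} (R : A → B → Set) {xs : List A} {ys : List B} → Unique xs →
  (∀ {x} → x ∈ xs → ∃ λ y → y ∈ ys × R x y) →
  (∀ {x x′ y} → x ∈ xs → x′ ∈ xs → R x y → R x′ y → x ≡ x′) →
  length xs ≤ length ys
unique-length-≤ R [] _ _ = z≤n
unique-length-≤ R {x ∷ xs} (x∉xs ∷ xs!) R-total R-injective
  with y , y∈ys , Rxy ← R-total (here refl)
  with as , bs , refl ← ∈-∃++ y∈ys =
  subst (suc (length xs) ≤_) (sym (length-++-sucʳ as y bs))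
    (s≤s (unique-length-≤ R xs! total′ (λ z∈ z′∈ → R-injective (there z∈) (there z′∈))))
  where
  total′ : ∀ {z} → z ∈ xs → ∃ λ t → t ∈ as ++ bs × R z t
  total′ z∈xs with t , t∈ , Rzt ← R-total (there z∈xs) with ∈-++⁻ as t∈
  ... | inj₁ t∈as         = t , ∈-++⁺ˡ t∈as , Rzt
  ... | inj₂ (there t∈bs) = t , ∈-++⁺ʳ as t∈bs , Rzt
  ... | inj₂ (here refl)  =
    contradiction (R-injective (here refl) (there z∈xs) Rxy Rzt) (All.lookup x∉xs z∈xs)

♯-injection : {A B : Set} {P : Pred A 0ℓ} {Q : Pred B 0ℓ} (P? : Decidable P) (Q? : Decidable Q)
  (R : A → B → Set) {xs : List A} {ys : List B} →
  Unique xs →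
  (∀ {x} → x ∈ xs → P x → ∃ λ y → y ∈ ys × Q y × R x y) →
  (∀ {x x′ y} → x ∈ xs → x′ ∈ xs → P x → P x′ → R x y → R x′ y → x ≡ x′) →
  ♯ P? xs ≤ ♯ Q? ys
♯-injection P? Q? R xs! total injective = unique-length-≤ R (Unique.filter⁺ P? xs!)
  (λ x∈ → let x∈xs , Px = ∈-filter⁻ P? x∈ ; y , y∈ys , Qy , Rxy = total x∈xs Px
          in y , ∈-filter⁺ Q? y∈ys Qy , Rxy)
  (λ x∈ x′∈ → let x∈xs , Px = ∈-filter⁻ P? x∈ ; x′∈xs , Px′ = ∈-filter⁻ P? x′∈
              in injective x∈xs x′∈xs Px Px′)

♯-mono : {A : Set} {P Q : Pred A 0ℓ} (P? : Decidable P) (Q? : Decidable Q) (xs : List A) →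
  (∀ {x} → x ∈ xs → P x → Q x) → ♯ P? xs ≤ ♯ Q? xs
♯-mono P? Q? []       P⊆Q = z≤n
♯-mono P? Q? (x ∷ xs) P⊆Q with ih ← ♯-mono P? Q? xs (P⊆Q ∘ there) | P? x | Q? x
... | yes _  | yes _  = s≤s ih
... | yes Px | no ¬Qx = contradiction (P⊆Q (here refl) Px) ¬Qx
... | no _   | yes _  = ℕₚ.m≤n⇒m≤1+n ih
... | no _   | no _   = ih

♯-cong : {A : Set} {P Q : Pred A 0ℓ} (P? : Decidable P) (Q? : Decidable Q) (xs : List A) →
  (∀ {x} → x ∈ xs → P x → Q x) → (∀ {x} → x ∈ xs → Q x → P x) → ♯ P? xs ≡ ♯ Q? xs
♯-cong P? Q? xs P⊆Q Q⊆P = ℕₚ.≤-antisym (♯-mono P? Q? xs P⊆Q) (♯-mono Q? P? xs Q⊆P)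

♯-strict : {A : Set} {P Q : Pred A 0ℓ} (P? : Decidable P) (Q? : Decidable Q) {z : A} {xs : List A} → z ∈ xs →
  (∀ {x} → x ∈ xs → P x → Q x) → ¬ P z → Q z → ♯ P? xs < ♯ Q? xs
♯-strict P? Q? {xs = x ∷ xs} z∈ P⊆Q ¬Pz Qz with P? x | Q? x | z∈
... | yes Px | no ¬Qx | _          = contradiction (P⊆Q (here refl) Px) ¬Qx
... | yes Px | yes _  | here refl  = contradiction Px ¬Pz
... | no _   | no ¬Qx | here refl  = contradiction Qz ¬Qx
... | no _   | yes _  | here refl  = s≤s (♯-mono P? Q? xs (P⊆Q ∘ there))
... | yes _  | yes _  | there z∈xs = s≤s (♯-strict P? Q? z∈xs (P⊆Q ∘ there) ¬Pz Qz)
... | no _   | yes _  | there z∈xs = ℕₚ.m≤n⇒m≤1+n (♯-strict P? Q? z∈xs (P⊆Q ∘ there) ¬Pz Qz)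
... | no _   | no _   | there z∈xs = ♯-strict P? Q? z∈xs (P⊆Q ∘ there) ¬Pz Qz

♯-∁ : {A : Set} {P : Pred A 0ℓ} (P? : Decidable P) (xs : List A) → ♯ P? xs + ♯ (¬? ∘ P?) xs ≡ length xs
♯-∁ P? []       = refl
♯-∁ P? (x ∷ xs) with P? x
... | yes _ = cong suc (♯-∁ P? xs)
... | no _  = trans (ℕₚ.+-suc _ _) (cong suc (♯-∁ P? xs))

♯-accept : {A : Set} {P : Pred A 0ℓ} (P? : Decidable P) {x : A}
  (xs : List A) → P x → ♯ P? (x ∷ xs) ≡ suc (♯ P? xs)
♯-accept P? xs Px = cong length (filter-accept P? Px)

♯-reject : {A : Set} {P : Pred A 0ℓ} (P? : Decidable P) {x : A}
  (xs : List A) → ¬ P x → ♯ P? (x ∷ xs) ≡ ♯ P? xs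
♯-reject P? xs ¬Px = cong length (filter-reject P? ¬Px)

-- Isolates the positions strictly between `i` and `k`, whose count becomes the `E` of an
-- `Exchange`; the position `i` itself falls into the first summand.
♯-split : {P : Pred ℕ 0ℓ} (P? : Decidable P) (i : ℕ) {k : ℕ} → i < k →
  ♯ P? (downFrom k) ≡
  ♯ P? (downFrom (suc i)) + ♯ (λ p → (i ℕₚ.<? p) ×-dec P? p) (downFrom k)
♯-split {P} P? i {suc k} i<1+k with ℕₚ.m≤n⇒m<n∨m≡n (s≤s⁻¹ i<1+k)
... | inj₂ refl = sym (trans (cong (♯ P? (downFrom (suc i)) +_) none) (ℕₚ.+-identityʳ _))
  where
  none : ♯ (λ p → (i ℕₚ.<? p) ×-dec P? p) (downFrom (suc i)) ≡ 0
  none = cong length (filter-none (λ p → (i ℕₚ.<? p) ×-dec P? p)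
    (All.tabulate λ p∈ (i<p , _) → ℕₚ.<⇒≱ i<p (s≤s⁻¹ (∈-downFrom⁻ p∈))))
... | inj₁ i<k = cases (P? k)
  where
  Q? = λ p → (i ℕₚ.<? p) ×-dec P? p
  low = ♯ P? (downFrom (suc i))

  cases : Dec (P k) → ♯ P? (downFrom (suc k)) ≡ low + ♯ Q? (downFrom (suc k))
  cases (yes Pk) = trans (♯-accept P? (downFrom k) Pk) (trans (cong suc (♯-split P? i i<k))
    (trans (sym (ℕₚ.+-suc _ _)) (cong (low +_) (sym (♯-accept Q? (downFrom k) (i<k , Pk))))))
  cases (no ¬Pk) = trans (♯-reject P? (downFrom k) ¬Pk) (trans (♯-split P? i i<k)
    (cong (low +_) (sym (♯-reject Q? (downFrom k) (¬Pk ∘ proj₂)))))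

♯-≤-suc : {A : Set} {P Q : Pred A 0ℓ} (P? : Decidable P) (Q? : Decidable Q) (z : A) {xs : List A} →
  Unique xs → (∀ {x} → x ∈ xs → P x → x ≡ z ⊎ Q x) → ♯ P? xs ≤ suc (♯ Q? xs)
♯-≤-suc P? Q? z {xs} xs! P⊆z∪Q = unique-length-≤ _≡_ (Unique.filter⁺ P? xs!) total
  λ { _ _ refl refl → refl }
  where
  total : ∀ {x} → x ∈ filter P? xs → ∃ λ y → y ∈ z ∷ filter Q? xs × x ≡ y
  total x∈ with x∈xs , Px ← ∈-filter⁻ P? x∈ with P⊆z∪Q x∈xs Px
  ... | inj₁ refl = _ , here refl , refl
  ... | inj₂ Qx   = _ , there (∈-filter⁺ Q? x∈xs Qx) , refl

-- Removing boxes from row lengths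

-- A missed value could be punched out of the codomain, leaving an injection of `Fin (suc n)` into
-- `Fin n`.
injective⇒hits : ∀ {n} {f : Fin n → Fin n} → Injective _≡_ _≡_ f → ∀ y → ∃ λ x → f x ≡ y
injective⇒hits {suc n} {f} f-injective y with Finₚ.any? (λ x → f x Finₚ.≟ y)
... | yes hit = hit
... | no ¬hit = contradiction (Finₚ.injective⇒≤ g-injective) ℕₚ.1+n≰n
  where
  miss : ∀ x → y ≢ f x
  miss x y≡fx = ¬hit (x , sym y≡fx)

  g-injective : Injective _≡_ _≡_ (λ x → punchOut (miss x))
  g-injective = f-injective ∘ Finₚ.punchOut-injective (miss _) (miss _)

Profile : Set
Profile = ℕ → ℕ

Antitone : Profile → Set
Antitone N = ∀ {j k} → j ≤ k → N k ≤ N j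

-- The trace of a removal on the conjugate partition: with rows sorted by decreasing length, the row
-- of rank `i` ends in the column `m` with `N (suc m) ≤ i < N m`. The choice among rows of equal
-- length leaves no trace.
record Drop (i : ℕ) (N N′ : Profile) : Set where
  field
    column  : ℕ
    above   : i < N column
    below   : N (suc column) ≤ i
    dropped : N column ≡ suc (N′ column)
    kept    : ∀ {k} → k ≢ column → N′ k ≡ N k

  kept-≤ : ∀ k → N′ k ≤ N k
  kept-≤ k with k ℕₚ.≟ column
  ... | yes refl = ℕₚ.≤-trans (ℕₚ.n≤1+n _) (ℕₚ.≤-reflexive (sym dropped))
  ... | no  k≢   = ℕₚ.≤-reflexive (kept k≢)

area : Profile → ℕ → ℕ
area N zero    = 0
area N (suc k) = area N k + N k

-- N ≼ M: the shape with column heights M is dominated by the shape with column heights N.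
infix 4 _≼_
_≼_ : Profile → Profile → Set
N ≼ M = ∀ k → area N k ≤ area M k

area-cong : ∀ {N M} → (∀ k → N k ≡ M k) → ∀ k → area N k ≡ area M k
area-cong N≗M zero    = refl
area-cong N≗M (suc k) = cong₂ _+_ (area-cong N≗M k) (N≗M k)

module _ {i N N′} (d : Drop i N N′) where
  open Drop d

  area-kept : ∀ {k} → k ≤ column → area N′ k ≡ area N k
  area-kept {zero}  _   = refl
  area-kept {suc k} k<m = cong₂ _+_ (area-kept (ℕₚ.<⇒≤ k<m)) (kept (ℕₚ.<⇒≢ k<m))

  area-dropped : ∀ {k} → column < k → area N k ≡ suc (area N′ k)
  area-dropped {suc k} m<1+k with ℕₚ.m≤n⇒m<n∨m≡n (s≤s⁻¹ m<1+k)
  ... | inj₁ m<k  = cong₂ _+_ (area-dropped m<k) (sym (kept (ℕₚ.>⇒≢ m<k)))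
  ... | inj₂ refl =
    trans (cong₂ _+_ (sym (area-kept ℕₚ.≤-refl)) dropped) (ℕₚ.+-suc _ _)

  area-≤ : N′ ≼ N
  area-≤ k with k ℕₚ.≤? column
  ... | yes k≤m = ℕₚ.≤-reflexive (area-kept k≤m)
  ... | no  k≰m = ℕₚ.≤-trans (ℕₚ.n≤1+n _) (ℕₚ.≤-reflexive (sym (area-dropped (ℕₚ.≰⇒> k≰m))))

-- Strictness at `k` is required only if `M` has lost its box before `k` and `N` has not. Then
-- `M k ≤ i′ ≤ i < N k`, so equal areas at `k` would violate the comparison at `suc k`.
drop-≼ : ∀ {i i′ N N′ M M′} → Antitone N → Antitone M → N ≼ M → i′ ≤ i →
  Drop i N N′ → Drop i′ M M′ → N′ ≼ M′
drop-≼ {i} {i′} {N} {N′} {M} {M′} N↓ M↓ N≼M i′≤i dN dM k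
  with k ℕₚ.≤? Drop.column dM | k ℕₚ.≤? Drop.column dN
... | yes k≤m′ | _ = subst (area N′ k ≤_) (sym (area-kept dM k≤m′)) (ℕₚ.≤-trans (area-≤ dN k) (N≼M k))
... | no k≰m′ | no k≰m = s≤s⁻¹ (subst₂ _≤_ (area-dropped dN (ℕₚ.≰⇒> k≰m))
                                          (area-dropped dM (ℕₚ.≰⇒> k≰m′)) (N≼M k))
... | no k≰m′ | yes k≤m = s≤s⁻¹ (subst₂ _<_ (sym (area-kept dN k≤m)) (area-dropped dM (ℕₚ.≰⇒> k≰m′)) N<M)
  where
  N<M : area N k < area M k
  N<M = ℕₚ.≰⇒> λ M≤N → ℕₚ.<⇒≱
    (ℕₚ.+-mono-≤-< M≤N (ℕₚ.≤-<-trans (ℕₚ.≤-trans (M↓ (ℕₚ.≰⇒> k≰m′)) (Drop.below dM))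
                         (ℕₚ.≤-<-trans i′≤i (ℕₚ.<-≤-trans (Drop.above dN) (N↓ k≤m)))))
    (N≼M (suc k))

-- Row lengths, ranks of rows and single removals

module _ {R : ℕ} where

  State : Set
  State = Fin R → ℕ

  opaque
    -- The height of column k, counted from 0.
    profile : State → Profile
    profile x k = ♯ (λ r → k ℕₚ.<? x r) (allFin R)

    profile-antitone : ∀ x → Antitone (profile x)
    profile-antitone x {j} {k} j≤k =
      ♯-mono (λ r → k ℕₚ.<? x r) (λ r → j ℕₚ.<? x r) (allFin R) λ _ → ℕₚ.≤-<-trans j≤k

    profile-≤ : ∀ x k → profile x k ≤ R
    profile-≤ x k = ℕₚ.≤-trans (length-filter (λ r → k ℕₚ.<? x r) (allFin R))
                               (ℕₚ.≤-reflexive (length-tabulate id))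

    profile-cong : ∀ {x y} → (∀ r → x r ≡ y r) → ∀ k → profile x k ≡ profile y k
    profile-cong {x} {y} x≗y k = ♯-cong (λ r → k ℕₚ.<? x r) (λ r → k ℕₚ.<? y r) (allFin R)
      (λ {r} _ → subst (k <_) (x≗y r)) (λ {r} _ → subst (k <_) (sym (x≗y r)))

    profile-zero : ∀ {x k} → (∀ r → x r ≤ k) → profile x k ≡ 0
    profile-zero {x} {k} x≤k = cong length (filter-none (λ r → k ℕₚ.<? x r)
      (All.universal (λ r → ℕₚ.≤⇒≯ (x≤k r)) (allFin R)))

  -- Condition (1) of a dimension pair for the last boxes of two rows, with `q` in row `r` and `p`
  -- in row `r′`.
  Ahead : State → Fin R → Fin R → Set
  Ahead x r r′ = x r ≡ x r′ × r′ Fin.< r ⊎ x r < x r′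

  ahead? : ∀ x r r′ → Dec (Ahead x r r′)
  ahead? x r r′ = ((x r ℕₚ.≟ x r′) ×-dec (r′ Finₚ.<? r)) ⊎-dec (x r ℕₚ.<? x r′)

  rank : State → Fin R → ℕ
  rank x r = ♯ (ahead? x r) (allFin R)

  ahead-irrefl : ∀ x r → ¬ Ahead x r r
  ahead-irrefl x r (inj₁ (_ , r<r)) = ℕₚ.<-irrefl refl r<r
  ahead-irrefl x r (inj₂ x<x)       = ℕₚ.<-irrefl refl x<x

  ahead-trans : ∀ x {r r′ r″} → Ahead x r r′ → Ahead x r′ r″ → Ahead x r r″
  ahead-trans x (inj₁ (e , l)) (inj₁ (e′ , l′)) = inj₁ (trans e e′ , ℕₚ.<-trans l′ l)
  ahead-trans x (inj₁ (e , l)) (inj₂ l′)        = inj₂ (ℕₚ.≤-<-trans (ℕₚ.≤-reflexive e) l′)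
  ahead-trans x (inj₂ l)       (inj₁ (e , _))   = inj₂ (ℕₚ.<-≤-trans l (ℕₚ.≤-reflexive e))
  ahead-trans x (inj₂ l)       (inj₂ l′)        = inj₂ (ℕₚ.<-trans l l′)

  ahead-total : ∀ x {r r′} → r ≢ r′ → Ahead x r r′ ⊎ Ahead x r′ r
  ahead-total x {r} {r′} r≢r′ with ℕₚ.<-cmp (x r) (x r′)
  ... | tri< l _ _ = inj₁ (inj₂ l)
  ... | tri> _ _ g = inj₂ (inj₂ g)
  ... | tri≈ _ e _ with Finₚ.<-cmp r r′
  ...   | tri< l _ _ = inj₂ (inj₁ (sym e , l))
  ...   | tri≈ _ q _ = contradiction q r≢r′
  ...   | tri> _ _ g = inj₁ (inj₁ (e , g))

  ahead⇒rank< : ∀ x {r r′} → Ahead x r r′ → rank x r′ < rank x r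
  ahead⇒rank< x {r} {r′} a = ♯-strict (ahead? x r′) (ahead? x r) (∈-allFin r′)
    (λ _ → ahead-trans x a) (ahead-irrefl x r′) a

  rank-injective : ∀ x {r r′} → rank x r ≡ rank x r′ → r ≡ r′
  rank-injective x {r} {r′} eq with r Finₚ.≟ r′
  ... | yes r≡r′ = r≡r′
  ... | no  r≢r′ with ahead-total x r≢r′
  ...   | inj₁ a = contradiction (sym eq) (ℕₚ.<⇒≢ (ahead⇒rank< x a))
  ...   | inj₂ a = contradiction eq (ℕₚ.<⇒≢ (ahead⇒rank< x a))

  rank<R : ∀ x r → rank x r < R
  rank<R x r = ℕₚ.<-≤-trans
    (♯-strict (ahead? x r) (λ _ → yes tt) (∈-allFin r) (λ _ _ → tt) (ahead-irrefl x r) tt)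
    (ℕₚ.≤-trans (length-filter _ (allFin R)) (ℕₚ.≤-reflexive (length-tabulate id)))

  record Step (i : ℕ) (x y : State) : Set where
    field
      row     : Fin R
      ranked  : rank x row ≡ i
      removed : x row ≡ suc (y row)
      kept    : ∀ {r} → r ≢ row → y r ≡ x r

    kept-≤ : ∀ r → y r ≤ x r
    kept-≤ r with r Finₚ.≟ row
    ... | yes refl = ℕₚ.≤-trans (ℕₚ.n≤1+n _) (ℕₚ.≤-reflexive (sym removed))
    ... | no  r≢   = ℕₚ.≤-reflexive (kept r≢)

  opaque
    unfolding profile

    step⇒drop : ∀ {i x y} → Step i x y → Drop i (profile x) (profile y)
    step⇒drop {x = x} {y} s@record { row = r₀ ; ranked = refl ; removed = removed ; kept = kept } = record
      -- Columns are counted from 0, so the last box of a row of length `suc (y r₀)` lies in column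
      -- `y r₀`. The bound `above` is strict because that column meets `r₀` as well as all rows
      -- ahead of it.
      { column  = y r₀
      ; above   = ♯-strict (ahead? x r₀) (λ r → y r₀ ℕₚ.<? x r) (∈-allFin r₀)
                    (λ { _ (inj₁ (e , _)) → subst (y r₀ <_) e y<x ; _ (inj₂ l) → ℕₚ.<-trans y<x l })
                    (ahead-irrefl x r₀) y<x
      ; below   = ♯-mono (λ r → suc (y r₀) ℕₚ.<? x r) (ahead? x r₀) (allFin R)
                    (λ _ → inj₂ ∘ ℕₚ.≤-<-trans (ℕₚ.≤-reflexive removed))
      ; dropped = ℕₚ.≤-antisym
          (♯-≤-suc (λ r → y r₀ ℕₚ.<? x r) (λ r → y r₀ ℕₚ.<? y r) r₀ (Unique.allFin⁺ R) survive)
          (♯-strict (λ r → y r₀ ℕₚ.<? y r) (λ r → y r₀ ℕₚ.<? x r) (∈-allFin r₀)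
            (λ {r} _ l → ℕₚ.<-≤-trans l (Step.kept-≤ s r)) (ℕₚ.<-irrefl refl) y<x)
      ; kept    = λ {k} k≢ → ♯-cong (λ r → k ℕₚ.<? y r) (λ r → k ℕₚ.<? x r) (allFin R)
          (λ {r} _ l → ℕₚ.<-≤-trans l (Step.kept-≤ s r)) (λ {r} _ → grow k≢ r)
      }
      where
      y<x : y r₀ < x r₀
      y<x = ℕₚ.≤-reflexive (sym removed)

      survive : ∀ {r} → r ∈ allFin R → y r₀ < x r → r ≡ r₀ ⊎ y r₀ < y r
      survive {r} _ l with r Finₚ.≟ r₀
      ... | yes r≡ = inj₁ r≡
      ... | no  r≢ = inj₂ (subst (y r₀ <_) (sym (kept r≢)) l)

      grow : ∀ {k} → k ≢ y r₀ → ∀ r → k < x r → k < y r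
      grow k≢ r l with r Finₚ.≟ r₀
      ... | yes refl = ℕₚ.≤∧≢⇒< (s≤s⁻¹ (subst (_ <_) removed l)) k≢
      ... | no  r≢   = subst (_ <_) (sym (kept r≢)) l

    -- `rank` injects the rows into `Fin R`, so every rank below `R` occurs. If the row of rank `i`
    -- were empty, all nonempty rows would be ahead of it, and there would be at most `i` of them.
    step-exists : ∀ {i} x → i < profile x 0 → ∃ (Step i x)
    step-exists {i} x i<N = updateAt x r₀ pred , record
      { row     = r₀
      ; ranked  = rank-r₀
      ; removed = trans (sym (ℕₚ.suc-pred (x r₀) ⦃ >-nonZero 0<x ⦄)) (cong suc (sym (updateAt-updates r₀ x)))
      ; kept    = λ {r} r≢ → updateAt-minimal r r₀ x r≢
      }
      where
      i<R : i < R
      i<R = ℕₚ.<-≤-trans i<N (profile-≤ x 0)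

      hit : ∃ λ r → fromℕ< (rank<R x r) ≡ fromℕ< i<R
      hit = injective⇒hits (λ {r} {r′} eq → rank-injective x
        (Finₚ.fromℕ<-injective _ _ (rank<R x r) (rank<R x r′) eq)) (fromℕ< i<R)

      r₀ : Fin R
      r₀ = proj₁ hit

      rank-r₀ : rank x r₀ ≡ i
      rank-r₀ = Finₚ.fromℕ<-injective _ _ (rank<R x r₀) i<R (proj₂ hit)

      0<x : 0 < x r₀
      0<x = ℕₚ.n≢0⇒n>0 λ x≡0 → ℕₚ.<⇒≱ i<N (subst (profile x 0 ≤_) rank-r₀
        (♯-mono (λ r → 0 ℕₚ.<? x r) (ahead? x r₀) (allFin R) λ _ → inj₂ ∘ ℕₚ.≤-<-trans (ℕₚ.≤-reflexive x≡0)))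

  Accept : (ℕ → ℕ) → ℕ → State → Set
  Accept c zero    x = ⊤
  Accept c (suc k) x = ∃ λ y → Step (c k) x y × Accept c k y

  infix 4 _⊴_
  _⊴_ : State → State → Set
  x ⊴ y = profile x ≼ profile y

  step-⊴ : ∀ {i i′ x x′ y y′} → x ⊴ y → i′ ≤ i → Step i x x′ → Step i′ y y′ → x′ ⊴ y′
  step-⊴ {x = x} {y = y} x⊴y i′≤i s s′ = drop-≼ (profile-antitone x) (profile-antitone y)
    x⊴y i′≤i (step⇒drop s) (step⇒drop s′)

  step-valid : ∀ {i x y} → Step i x y → i < profile x 0
  step-valid {x = x} s = ℕₚ.<-≤-trans (Drop.above (step⇒drop s)) (profile-antitone x z≤n)

  accept-⊴ : ∀ {c c′ : ℕ → ℕ} k {x y} → x ⊴ y → (∀ {j} → j < k → c′ j ≤ c j) →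
    Accept c k x → Accept c′ k y
  accept-⊴ zero    _   _    _             = tt
  accept-⊴ (suc k) {y = y} x⊴y c′≤c (x′ , s , acc) =
    -- At 1, `x⊴y` compares the heights of the first columns, which bound the usable indices.
    let y′ , s′ = step-exists y (ℕₚ.≤-<-trans (c′≤c ℕₚ.≤-refl) (ℕₚ.<-≤-trans (step-valid s) (x⊴y 1)))
    in y′ , s′ , accept-⊴ k (step-⊴ x⊴y (c′≤c ℕₚ.≤-refl) s s′) (c′≤c ∘ ℕₚ.m<n⇒m<1+n) acc

-- Two-column and three-row shapes

drop-column-unique : ∀ {i N N′ m} → Antitone N → (d : Drop i N N′) →
  i < N m → N (suc m) ≤ i → Drop.column d ≡ m
drop-column-unique {m = m} N↓ d i<Nm N≤i with ℕₚ.<-cmp (Drop.column d) m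
... | tri< c<m _ _ = contradiction (ℕₚ.≤-trans (N↓ c<m) (Drop.below d)) (ℕₚ.<⇒≱ i<Nm)
... | tri≈ _ c≡m _ = c≡m
... | tri> _ _ m<c = contradiction (ℕₚ.≤-trans (N↓ m<c) N≤i) (ℕₚ.<⇒≱ (Drop.above d))

drop-same-column : ∀ {i i′ N N′ M M′} → (∀ k → N k ≡ M k) →
  (d : Drop i N N′) (d′ : Drop i′ M M′) → Drop.column d ≡ Drop.column d′ → ∀ k → N′ k ≡ M′ k
drop-same-column N≗M d d′ refl k with k ℕₚ.≟ Drop.column d
... | yes refl = ℕₚ.suc-injective (trans (sym (Drop.dropped d)) (trans (N≗M k) (Drop.dropped d′)))
... | no  k≢   = trans (Drop.kept d k≢) (trans (N≗M k) (sym (Drop.kept d′ k≢)))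

drop-cong : ∀ {i N N′ M M′} → Antitone N → (∀ k → N k ≡ M k) →
  Drop i N N′ → Drop i M M′ → ∀ k → N′ k ≡ M′ k
drop-cong {i} N↓ N≗M d d′ = drop-same-column N≗M d d′ (drop-column-unique N↓ d
  (subst (i <_) (sym (N≗M _)) (Drop.above d′)) (subst (_≤ i) (sym (N≗M _)) (Drop.below d′)))

-- Compares columns where `drop-≼` compares indices. This serves position `i`, where the index may
-- rise on the dominating side.
drop-≼-column : ∀ {i i′ N N′ M M′} → N ≼ M → (d : Drop i N N′) (d′ : Drop i′ M M′) →
  Drop.column d ≤ Drop.column d′ → N′ ≼ M′
drop-≼-column {N′ = N′} N≼M d d′ c≤c′ k with k ℕₚ.≤? Drop.column d′
... | yes k≤c′ = subst (area N′ k ≤_) (sym (area-kept d′ k≤c′)) (ℕₚ.≤-trans (area-≤ d k) (N≼M k))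
... | no  k≰c′ = s≤s⁻¹ (subst₂ _≤_ (area-dropped d (ℕₚ.≤-<-trans c≤c′ (ℕₚ.≰⇒> k≰c′)))
                                  (area-dropped d′ (ℕₚ.≰⇒> k≰c′)) (N≼M k))

drop-head : ∀ {i N N′} → Drop i N N′ → N 0 ≤ suc (N′ 0)
drop-head {N = N} {N′} d with Drop.column d ℕₚ.≟ 0
... | yes col≡0 = ℕₚ.≤-reflexive (subst (λ k → N k ≡ suc (N′ k)) col≡0 (Drop.dropped d))
... | no  col≢0 = ℕₚ.m≤n⇒m≤1+n (ℕₚ.≤-reflexive (sym (Drop.kept d (col≢0 ∘ sym))))

≗⇒≼ : ∀ {N M} → (∀ k → N k ≡ M k) → N ≼ M
≗⇒≼ N≗M k = ℕₚ.≤-reflexive (area-cong N≗M k)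

-- The codes c of w and c′ of v, for a Bruhat cover that undoes the inversion i < j of w. A and G
-- count the positions before i with values above w i and above w j; E q counts the positions
-- strictly between i and q with values above w j.
record Exchange (i j : ℕ) (c c′ : ℕ → ℕ) : Set where
  field
    i<j     : i < j
    A G     : ℕ
    E       : ℕ → ℕ
    A≤G     : A ≤ G
    E-start : E (suc i) ≡ 0
    -- The additional 1 is the position `i` itself.
    at-j    : c j ≡ suc (G + E j)
    at-j′   : c′ j ≤ A + E j
    between : ∀ {q} → i < q → q < j → c′ q ≡ c q
    -- With no value between `w j` and `w i`, the value at `q` is above both or below both; `E`
    -- counts the first kind.
    upper⊎lower : ∀ {q} → i < q → q < j →
      (c q ≤ A + E q × E (suc q) ≡ suc (E q)) ⊎ (suc (G + E q) ≤ c q × E (suc q) ≡ E q)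
    at-i    : c i ≡ A
    at-i′   : c′ i ≤ G
    early   : ∀ {q} → q < i → c′ q ≤ c q

  at-j-≤ : c′ j ≤ c j
  at-j-≤ = ℕₚ.≤-trans at-j′ (ℕₚ.≤-trans (ℕₚ.+-monoˡ-≤ (E j) A≤G)
    (ℕₚ.≤-trans (ℕₚ.n≤1+n _) (ℕₚ.≤-reflexive (sym at-j))))

module _ {R : ℕ} where

  TwoColumn : State {R} → Set
  TwoColumn x = profile x 2 ≡ 0

  two-column-step : ∀ {l x y} → TwoColumn x → Step l x y → TwoColumn y
  two-column-step t s = ℕₚ.n≤0⇒n≡0 (ℕₚ.≤-trans (Drop.kept-≤ (step⇒drop s) 2) (ℕₚ.≤-reflexive t))

  first : ∀ {l} {x y : State {R}} (s : Step l x y) → profile x 1 ≤ l → Drop.column (step⇒drop s) ≡ 0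
  first {x = x} s N≤l = drop-column-unique (profile-antitone x) (step⇒drop s) (step-valid s) N≤l

  second : ∀ {l x y} → TwoColumn x → (s : Step l x y) → l < profile x 1 →
    Drop.column (step⇒drop s) ≡ 1
  second {x = x} t s l<N = drop-column-unique (profile-antitone x) (step⇒drop s) l<N
    (ℕₚ.≤-trans (ℕₚ.≤-reflexive t) z≤n)

  first-drop : ∀ {l} {x y : State {R}} → Step l x y → profile x 1 ≤ l →
    profile x 0 ≡ suc (profile y 0) × profile y 1 ≡ profile x 1
  first-drop s N≤l with step⇒drop s | first s N≤l
  ... | d | refl = Drop.dropped d , Drop.kept d (λ ())

  second-drop : ∀ {l x y} → TwoColumn x → Step l x y → l < profile x 1 →
    profile y 0 ≡ profile x 0 × profile x 1 ≡ suc (profile y 1)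
  second-drop t s l<N with step⇒drop s | second t s l<N
  ... | d | refl = Drop.kept d (λ ()) , Drop.dropped d

  two-column-⊴ : ∀ {x y} → TwoColumn x → profile x 0 ≤ profile y 0 →
    profile x 0 + profile x 1 ≤ profile y 0 + profile y 1 → x ⊴ y
  two-column-⊴ t p q zero                = z≤n
  two-column-⊴ t p q (suc zero)          = p
  two-column-⊴ t p q (suc (suc zero))    = q
  two-column-⊴ {x} {y} t p q (suc (suc (suc k))) = ℕₚ.≤-trans
    (ℕₚ.≤-reflexive (trans (cong (area (profile x) (suc (suc k)) +_) none) (ℕₚ.+-identityʳ _)))
    (ℕₚ.≤-trans (two-column-⊴ {x} {y} t p q (suc (suc k))) (ℕₚ.m≤m+n _ _))
    where
    none : profile x (suc (suc k)) ≡ 0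
    none = ℕₚ.n≤0⇒n≡0 (ℕₚ.≤-trans (profile-antitone x (s≤s (s≤s z≤n))) (ℕₚ.≤-reflexive t))

module TwoColumns (R : ℕ) {i j c c′} (e : Exchange i j c c′) where
  open Exchange e

  -- The second column height of x lies below, above or inside the interval
  -- (A + E k, G + E k + 1]. No c q lies strictly between its ends, so the alternative persists.
  data Inv (k : ℕ) (x x′ : State {R}) : Set where
    low  : x ⊴ x′ → profile x 1 ≤ A + E k → Inv k x x′
    high : (∀ m → profile x m ≡ profile x′ m) → suc (G + E k) ≤ profile x 1 → Inv k x x′
    mid  : profile x′ 0 ≡ suc (profile x 0) → profile x 1 ≡ suc (profile x′ 1) →
           A + E k < profile x 1 → profile x 1 ≤ suc (G + E k) → Inv k x x′

  inv-valid : ∀ {k x x′} → Inv k x x′ → profile x 0 ≤ profile x′ 0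
  inv-valid (low x⊴x′ _)  = x⊴x′ 1
  inv-valid (high N≗N′ _) = ℕₚ.≤-reflexive (N≗N′ 0)
  inv-valid (mid p _ _ _) = ℕₚ.≤-trans (ℕₚ.n≤1+n _) (ℕₚ.≤-reflexive (sym p))

  -- A removal hits the second column exactly when its index is below the height of that column.
  -- That height is compared with `A + E j`, which bounds `c′ j`, and with `c j`; if it lies between
  -- them, `c` takes the first column and `c′` the second.
  inv-start : ∀ {x y y′} → TwoColumn x → Step (c j) x y → Step (c′ j) x y′ → Inv j y y′
  inv-start {x} {y} {y′} t s s′ with profile x 1 ℕₚ.≤? A + E j | profile x 1 ℕₚ.≤? c j
  ... | yes N≤ | _ = low (step-⊴ {x = x} {y = x} (λ _ → ℕₚ.≤-refl) at-j-≤ s s′)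
                         (ℕₚ.≤-trans (Drop.kept-≤ (step⇒drop s) 1) N≤)
  ... | no _ | no N≰c = high
    (drop-same-column (λ _ → refl) (step⇒drop s) (step⇒drop s′)
      (trans (second t s c<N) (sym (second t s′ (ℕₚ.≤-<-trans at-j-≤ c<N)))))
    (subst (_≤ profile y 1) at-j (s≤s⁻¹ (subst (c j <_) (proj₂ (second-drop t s c<N)) c<N)))
    where c<N = ℕₚ.≰⇒> N≰c
  ... | no N≰ | yes N≤c =
    let p , q = first-drop s N≤c
        p′ , q′ = second-drop t s′ (ℕₚ.≤-<-trans at-j′ (ℕₚ.≰⇒> N≰))
    in mid
    (trans p′ p)
    (trans q q′)
    (subst (A + E j <_) (sym q) (ℕₚ.≰⇒> N≰))
    (subst₂ _≤_ (sym q) at-j N≤c)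

  inv-step : ∀ {q x x′ y y′} → TwoColumn x → TwoColumn x′ → i < q → q < j →
    Step (c q) x y → Step (c q) x′ y′ → Inv (suc q) x x′ → Inv q y y′
  inv-step {q} {x} {x′} {y} t t′ i<q q<j s s′ (low x⊴x′ N≤) =
    low (step-⊴ {x = x} {y = x′} x⊴x′ ℕₚ.≤-refl s s′) (bound (upper⊎lower i<q q<j))
    where
    bound : _ → profile y 1 ≤ A + E q
    bound (inj₂ (_ , same)) = ℕₚ.≤-trans (Drop.kept-≤ (step⇒drop s) 1) (subst (λ z → _ ≤ A + z) same N≤)
    bound (inj₁ (c≤ , up)) with profile x 1 ℕₚ.≤? c q
    ... | yes N≤c = ℕₚ.≤-trans (Drop.kept-≤ (step⇒drop s) 1) (ℕₚ.≤-trans N≤c c≤)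
    ... | no  N≰c = s≤s⁻¹ (subst₂ _≤_ (proj₂ (second-drop t s (ℕₚ.≰⇒> N≰c)))
                      (trans (cong (A +_) up) (ℕₚ.+-suc A (E q))) N≤)
  inv-step {q} {x} {x′} {y} t t′ i<q q<j s s′ (high N≗N′ N≥) =
    high (drop-cong (profile-antitone x) N≗N′ (step⇒drop s) (step⇒drop s′)) (bound (upper⊎lower i<q q<j))
    where
    bound : _ → suc (G + E q) ≤ profile y 1
    bound u with profile x 1 ℕₚ.≤? c q
    bound (inj₁ (_ , up)) | yes N≤c = subst (suc (G + E q) ≤_) (sym (proj₂ (first-drop s N≤c)))
      (ℕₚ.≤-trans (s≤s (ℕₚ.+-monoʳ-≤ G (ℕₚ.≤-trans (ℕₚ.n≤1+n _) (ℕₚ.≤-reflexive (sym up))))) N≥)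
    bound (inj₂ (_ , same)) | yes N≤c = subst₂ (λ u v → suc (G + u) ≤ v) same
      (sym (proj₂ (first-drop s N≤c))) N≥
    bound (inj₁ (_ , up)) | no N≰c = s≤s⁻¹ (subst₂ (λ u v → suc u ≤ v)
      (trans (cong (G +_) up) (ℕₚ.+-suc G (E q))) (proj₂ (second-drop t s (ℕₚ.≰⇒> N≰c))) N≥)
    bound (inj₂ (c≥ , _)) | no N≰c = ℕₚ.≤-trans c≥
      (s≤s⁻¹ (subst (c q <_) (proj₂ (second-drop t s (ℕₚ.≰⇒> N≰c))) (ℕₚ.≰⇒> N≰c)))
  -- An upper code is below both second column heights, a lower one is at least as large as both. So
  -- the two processes use the same column and keep their difference.
  inv-step {q} {x} {x′} {y} t t′ i<q q<j s s′ (mid p r N> N≤) with upper⊎lower i<q q<j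
  ... | inj₁ (c≤ , up) =
    let N>′ = subst₂ _<_ (trans (cong (A +_) up) (ℕₚ.+-suc A (E q))) r N>
        c<N′ = ℕₚ.≤-<-trans c≤ (s≤s⁻¹ N>′)
        p₁ , q₁ = second-drop t s (ℕₚ.<-≤-trans c<N′ (ℕₚ.≤-trans (ℕₚ.n≤1+n _) (ℕₚ.≤-reflexive (sym r))))
        p₂ , q₂ = second-drop t′ s′ c<N′
    in mid
      (trans p₂ (trans p (cong suc (sym p₁))))
      (trans (ℕₚ.suc-injective (trans (sym q₁) r)) q₂)
      (s≤s⁻¹ (subst₂ _<_ (trans (cong (A +_) up) (ℕₚ.+-suc A (E q))) q₁ N>))
      (s≤s⁻¹ (subst₂ (λ u v → u ≤ suc v) q₁ (trans (cong (G +_) up) (ℕₚ.+-suc G (E q))) N≤))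
  ... | inj₂ (c≥ , same) =
    let N≤c = ℕₚ.≤-trans N≤ (subst (λ z → suc (G + z) ≤ c q) (sym same) c≥)
        p₁ , q₁ = first-drop s N≤c
        p₂ , q₂ = first-drop s′ (ℕₚ.≤-trans (ℕₚ.n≤1+n _) (ℕₚ.≤-trans (ℕₚ.≤-reflexive (sym r)) N≤c))
    in mid
      (ℕₚ.suc-injective (trans (sym p₂) (trans p (cong suc p₁))))
      (trans q₁ (trans r (cong suc (sym q₂))))
      (subst₂ (λ u v → A + u < v) same (sym q₁) N>)
      (subst₂ (λ u v → v ≤ suc (G + u)) same (sym q₁) N≤)

  A+E≡c : A + E (suc i) ≡ c i
  A+E≡c = trans (cong (A +_) E-start) (trans (ℕₚ.+-identityʳ A) (sym at-i))

  inv-end : ∀ {x x′ y y′} → TwoColumn x → TwoColumn x′ →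
    Step (c i) x y → Step (c′ i) x′ y′ → Inv (suc i) x x′ → y ⊴ y′
  inv-end {x} {x′} t t′ s s′ (low x⊴x′ N≤) = drop-≼-column x⊴x′ (step⇒drop s) (step⇒drop s′)
    (ℕₚ.≤-trans (ℕₚ.≤-reflexive (first s N≤c)) z≤n)
    where
    N≤c : profile x 1 ≤ c i
    N≤c = subst (profile x 1 ≤_) A+E≡c N≤
  inv-end {x} {x′} t t′ s s′ (high N≗N′ N≥) = drop-≼-column (≗⇒≼ N≗N′) (step⇒drop s) (step⇒drop s′)
    (ℕₚ.≤-reflexive (trans (second t s (ℕₚ.≤-<-trans (ℕₚ.≤-trans (ℕₚ.≤-reflexive at-i) A≤G) G<N))
                      (sym (second t′ s′ (ℕₚ.≤-<-trans at-i′ (subst (G <_) (N≗N′ 1) G<N))))))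
    where
    G<N : G < profile x 1
    G<N = ℕₚ.≤-trans (s≤s (ℕₚ.m≤m+n G (E (suc i)))) N≥
  -- Here `x` loses a box of its second column. If `x′` loses one of its first, the heights become
  -- equal; otherwise `y′` has one box more in the first column and one less in the second.
  inv-end {x} {x′} {y} {y′} t t′ s s′ (mid p r N> _) with profile x′ 1 ℕₚ.≤? c′ i
  ... | yes N′≤c =
    let p₁ , q₁ = second-drop t s (subst (_< profile x 1) A+E≡c N>)
        p₂ , q₂ = first-drop s′ N′≤c
        p₃ = trans p₁ (ℕₚ.suc-injective (trans (sym p) p₂))
        q₃ = trans (ℕₚ.suc-injective (trans (sym q₁) r)) (sym q₂)
    in two-column-⊴ {x = y} {y′} (two-column-step t s)
         (ℕₚ.≤-reflexive p₃) (ℕₚ.≤-reflexive (cong₂ _+_ p₃ q₃))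
  ... | no N′≰c =
    let p₁ , q₁ = second-drop t s (subst (_< profile x 1) A+E≡c N>)
        p₂ , q₂ = second-drop t′ s′ (ℕₚ.≰⇒> N′≰c)
        p₃ = trans (cong suc p₁) (trans (sym p) (sym p₂))
        q₃ = trans (ℕₚ.suc-injective (trans (sym q₁) r)) q₂
    in two-column-⊴ {x = y} {y′} (two-column-step t s)
         (ℕₚ.≤-trans (ℕₚ.n≤1+n _) (ℕₚ.≤-reflexive p₃))
         (ℕₚ.≤-reflexive (trans (cong (profile y 0 +_) q₃)
           (trans (ℕₚ.+-suc _ _) (cong (_+ profile y′ 1) p₃))))

  -- Acceptance of `c` does not bound `c′ i`, which may exceed `c i`. The bound started here is
  -- carried down to `suc i`, where it gives `G < profile x 0` and so makes the index `c′ i` usable.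
  room-start : ∀ {x y : State {R}} → Step (c j) x y → suc (G + E j) ≤ profile y 0
  room-start s = s≤s⁻¹ (ℕₚ.≤-trans (subst (_< _) at-j (step-valid s)) (drop-head (step⇒drop s)))

  room-step : ∀ {q} {x y : State {R}} → i < q → q < j → Step (c q) x y →
    suc (G + E (suc q)) ≤ profile x 0 → suc (G + E q) ≤ profile y 0
  -- Passing an upper position lowers `E` by one, which pays for a box lost in the first column. At
  -- a lower position that uses the first column, the validity of `c q` renews the bound.
  room-step {q} i<q q<j s room with upper⊎lower i<q q<j
  ... | inj₁ (_ , up) = s≤s⁻¹ (ℕₚ.≤-trans
    (ℕₚ.≤-reflexive (cong suc (sym (trans (cong (G +_) up) (ℕₚ.+-suc G (E q))))))
    (ℕₚ.≤-trans room (drop-head (step⇒drop s))))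
  ... | inj₂ (c≥ , same) with Drop.column (step⇒drop s) ℕₚ.≟ 0
  ...   | yes col≡0 = ℕₚ.≤-trans c≥ (s≤s⁻¹ (ℕₚ.≤-trans (step-valid s) (drop-head (step⇒drop s))))
  ...   | no  col≢0 = subst₂ (λ u v → suc (G + u) ≤ v) same
                        (sym (Drop.kept (step⇒drop s) (col≢0 ∘ sym))) room

  walk : ∀ k {x x′} → TwoColumn x → TwoColumn x′ → i < k → k ≤ j →
    suc (G + E k) ≤ profile x 0 → Inv k x x′ → Accept c k x → Accept c′ k x′
  walk (suc q) {x} {x′} t t′ i<k k≤j room inv (y , s , acc) with ℕₚ.m≤n⇒m<n∨m≡n (s≤s⁻¹ i<k)
  ... | inj₂ refl =
    let y′ , s′ = step-exists x′ (ℕₚ.≤-<-trans at-i′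
                    (ℕₚ.≤-trans (s≤s (ℕₚ.m≤m+n G _)) (ℕₚ.≤-trans room (inv-valid inv))))
    in y′ , s′ , accept-⊴ q (inv-end t t′ s s′ inv) early acc
  ... | inj₁ i<q =
    let y′ , s′ = step-exists x′ (ℕₚ.<-≤-trans (step-valid s) (inv-valid inv))
    in y′ , subst (λ l → Step l x′ y′) (sym (between i<q k≤j)) s′ ,
       walk q (two-column-step t s) (two-column-step t′ s′) i<q (ℕₚ.<⇒≤ k≤j)
         (room-step i<q k≤j s room) (inv-step t t′ i<q k≤j s s′ inv) acc

  exchange-accept : ∀ {x} → TwoColumn x → Accept c (suc j) x → Accept c′ (suc j) x
  exchange-accept {x} t (y , s , acc) =
    let y′ , s′ = step-exists x (ℕₚ.≤-<-trans at-j-≤ (step-valid s))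
    in y′ , s′ , walk j (two-column-step t s) (two-column-step t s′) i<j ℕₚ.≤-refl
                   (room-start s) (inv-start t s s′) acc

ThreeRow : ∀ {R} → State {R} → Set
ThreeRow x = profile x 0 ≤ 3

three-row-step : ∀ {R l} {x y : State {R}} → ThreeRow x → Step l x y → ThreeRow y
three-row-step t s = ℕₚ.≤-trans (Drop.kept-≤ (step⇒drop s) 0) t

module ThreeRows (R : ℕ) {i j c c′} (e : Exchange i j c c′) where
  open Exchange e

  full : ∀ {x : State {R}} {k} → ThreeRow x → 2 < profile x k → profile x k ≡ 3
  full {x} t 2<N = ℕₚ.≤-antisym (ℕₚ.≤-trans (profile-antitone x z≤n) t) 2<N

  -- In the second case x and x′ are the same shape minus a box in column m, respectively M.
  data Inv (x x′ : State {R}) : Set where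
    same : ∀ M → (∀ k → profile x k ≡ profile x′ k) →
      profile x M ≡ 2 → profile x (suc M) ≡ 0 → Inv x x′
    diff : ∀ m M → m < M →
      profile x m ≡ 2 → profile x′ m ≡ 3 → profile x′ (suc m) ≤ 2 →
      profile x M ≡ suc (profile x′ M) → profile x (suc M) ≡ 0 →
      (∀ {k} → k ≢ m → k ≢ M → profile x k ≡ profile x′ k) → Inv x x′

  -- Index 2 takes the last column of height 3 and index 0 the last nonempty column. If these
  -- coincide, the column is left with height 2 and nothing to its right, as `same` records.
  inv-start : ∀ {x y y′} → ThreeRow x → Step 2 x y → Step 0 x y′ → Inv y y′
  inv-start {x} {y} {y′} t s s′ = cases (ℕₚ.<-cmp m M)
    where
    d  = step⇒drop s
    d′ = step⇒drop s′
    m  = Drop.column d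
    M  = Drop.column d′

    Nm≡3 : profile x m ≡ 3
    Nm≡3 = full t (Drop.above d)

    N′m≡2 : profile y m ≡ 2
    N′m≡2 = ℕₚ.suc-injective (trans (sym (Drop.dropped d)) Nm≡3)

    end : profile y (suc M) ≡ 0
    end = ℕₚ.n≤0⇒n≡0 (ℕₚ.≤-trans (Drop.kept-≤ d (suc M)) (Drop.below d′))

    cases : _ → Inv y y′
    cases (tri< m<M m≢M _) = diff m M m<M N′m≡2 (trans (Drop.kept d′ m≢M) Nm≡3)
      (ℕₚ.≤-trans (Drop.kept-≤ d′ (suc m)) (Drop.below d))
      (trans (Drop.kept d (m≢M ∘ sym)) (Drop.dropped d′)) end
      (λ k≢m k≢M → trans (Drop.kept d k≢m) (sym (Drop.kept d′ k≢M)))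
    cases (tri≈ _ m≡M _) = same M (drop-same-column (λ _ → refl) d d′ m≡M)
      (subst (λ k → profile y k ≡ 2) m≡M N′m≡2) end
    cases (tri> _ _ M<m) = contradiction (ℕₚ.<-≤-trans (Drop.above d) (profile-antitone x M<m))
      (λ 2<N → ℕₚ.<⇒≱ 2<N (ℕₚ.≤-trans (Drop.below d′) z≤n))

  inv-step : ∀ {x x′ y y′} → ThreeRow x → Step 2 x y → Step 2 x′ y′ → Inv x x′ → Inv y y′
  inv-step {x} t s s′ (same M N≗N′ NM≡2 end) = same M
    (drop-cong (profile-antitone x) N≗N′ d (step⇒drop s′))
    (trans (Drop.kept d (λ { refl → ℕₚ.<-irrefl (sym NM≡2) (Drop.above d) })) NM≡2)
    (ℕₚ.n≤0⇒n≡0 (ℕₚ.≤-trans (Drop.kept-≤ d (suc M)) (ℕₚ.≤-reflexive end)))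
    where d = step⇒drop s
  -- Column `m` is the last of height 3 in `x′`, so `x′` now loses the box there that `x` already
  -- lacks, while `x` turns to a column `m₁` further left. The discrepancy moves from `m` to `m₁`.
  inv-step {x} {x′} {y} {y′} t s s′ (diff m M m<M Nm N′m N′≤2 NM end agree) = diff m₁ M m₁<M
    (ℕₚ.suc-injective (trans (sym (Drop.dropped d)) (full t (Drop.above d))))
    (trans (kept′ (ℕₚ.<⇒≢ m₁<m)) (trans (sym (agree (ℕₚ.<⇒≢ m₁<m) (ℕₚ.<⇒≢ m₁<M))) (full t (Drop.above d))))
    next
    (trans (Drop.kept d (ℕₚ.>⇒≢ m₁<M)) (trans NM (cong suc (sym (kept′ (ℕₚ.>⇒≢ m<M))))))
    (ℕₚ.n≤0⇒n≡0 (ℕₚ.≤-trans (Drop.kept-≤ d (suc M)) (ℕₚ.≤-reflexive end)))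
    agree′
    where
    d  = step⇒drop s
    d′ = step⇒drop s′
    m₁ = Drop.column d

    m′≡m : Drop.column d′ ≡ m
    m′≡m = drop-column-unique (profile-antitone x′) d′ (ℕₚ.≤-reflexive (sym N′m)) N′≤2

    kept′ : ∀ {k} → k ≢ m → profile y′ k ≡ profile x′ k
    kept′ k≢m = Drop.kept d′ (λ k≡ → k≢m (trans k≡ m′≡m))

    m₁<m : m₁ < m
    m₁<m = ℕₚ.≰⇒> λ m≤m₁ → ℕₚ.<⇒≱ (Drop.above d)
      (ℕₚ.≤-trans (profile-antitone x m≤m₁) (ℕₚ.≤-reflexive Nm))

    m₁<M : m₁ < M
    m₁<M = ℕₚ.<-trans m₁<m m<M

    y′m≡2 : profile y′ m ≡ 2
    y′m≡2 = ℕₚ.suc-injective (trans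
      (sym (subst (λ k → profile x′ k ≡ suc (profile y′ k)) m′≡m (Drop.dropped d′))) N′m)

    next : profile y′ (suc m₁) ≤ 2
    next with suc m₁ ℕₚ.≟ m
    ... | yes refl = ℕₚ.≤-reflexive y′m≡2
    ... | no  ≢m   = subst (_≤ 2)
      (trans (agree ≢m (ℕₚ.<⇒≢ (ℕₚ.≤-<-trans m₁<m m<M))) (sym (kept′ ≢m))) (Drop.below d)

    agree′ : ∀ {k} → k ≢ m₁ → k ≢ M → profile y k ≡ profile y′ k
    agree′ {k} k≢m₁ k≢M with k ℕₚ.≟ m
    ... | yes refl = trans (Drop.kept d k≢m₁) (trans Nm (sym y′m≡2))
    ... | no  k≢m  = trans (Drop.kept d k≢m₁) (trans (agree k≢m k≢M) (sym (kept′ k≢m)))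

  inv-end : ∀ {l x x′ y y′} → l ≤ 1 → Step 0 x y → Step l x′ y′ → Inv x x′ → y ⊴ y′
  inv-end {l} {x} {x′} l≤1 s s′ (same M N≗N′ NM≡2 end) =
    drop-≼-column (≗⇒≼ N≗N′) (step⇒drop s) (step⇒drop s′) (ℕₚ.≤-reflexive (trans
      (drop-column-unique (profile-antitone x) (step⇒drop s) (subst (0 <_) (sym NM≡2) z<s) (ℕₚ.≤-reflexive end))
      (sym (drop-column-unique (profile-antitone x′) (step⇒drop s′)
        (subst (l <_) (trans (sym NM≡2) (N≗N′ M)) (s≤s l≤1))
        (ℕₚ.≤-trans (ℕₚ.≤-reflexive (trans (sym (N≗N′ (suc M))) end)) z≤n)))))
  inv-end {l} {x} {x′} {y} l≤1 s s′ (diff m M m<M Nm N′m N′≤2 NM end agree) =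
    drop-≼ (profile-antitone x′) (profile-antitone x′) (λ _ → ℕₚ.≤-refl) (ℕₚ.m≤n⇒m≤1+n l≤1)
      virtual (step⇒drop s′)
    where
    d = step⇒drop s

    col≡M : Drop.column d ≡ M
    col≡M = drop-column-unique (profile-antitone x) d (subst (0 <_) (sym NM) z<s) (ℕₚ.≤-reflexive end)

    kept : ∀ {k} → k ≢ M → profile y k ≡ profile x k
    kept k≢M = Drop.kept d (λ k≡ → k≢M (trans k≡ col≡M))

    -- x has already lost column m, so y is also x′ with a box removed from column m.
    virtual : Drop 2 (profile x′) (profile y)
    virtual = record
      { column  = m
      ; above   = ℕₚ.≤-reflexive (sym N′m)
      ; below   = N′≤2
      ; dropped = trans N′m (cong suc (sym (trans (kept (ℕₚ.<⇒≢ m<M)) Nm)))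
      ; kept    = kept″
      }
      where
      kept″ : ∀ {k} → k ≢ m → profile y k ≡ profile x′ k
      kept″ {k} k≢m with k ℕₚ.≟ M
      ... | yes refl = ℕₚ.suc-injective (trans
              (sym (subst (λ k → profile x k ≡ suc (profile y k)) col≡M (Drop.dropped d))) NM)
      ... | no  k≢M  = trans (kept k≢M) (agree k≢m k≢M)

  inv-valid : ∀ {x x′} → Inv x x′ → 1 < profile x′ 0 × (2 < profile x 0 → 2 < profile x′ 0)
  inv-valid {x′ = x′} (same M N≗N′ NM≡2 _) =
    ℕₚ.≤-trans (ℕₚ.≤-reflexive (trans (sym NM≡2) (N≗N′ M))) (profile-antitone x′ z≤n) ,
    subst (2 <_) (N≗N′ 0)
  inv-valid {x′ = x′} (diff m _ _ _ N′m _ _ _ _) = ℕₚ.<-trans (s≤s (s≤s z≤n)) 2<N′ , λ _ → 2<N′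
    where
    2<N′ : 2 < profile x′ 0
    2<N′ = ℕₚ.≤-trans (ℕₚ.≤-reflexive (sym N′m)) (profile-antitone x′ z≤n)

  module _ (A≡0 : A ≡ 0) (G≡1 : G ≡ 1) where

    walk : ∀ k {x x′} → ThreeRow x → i < k → k ≤ j → E k ≡ 0 →
      Inv x x′ → Accept c k x → Accept c′ k x′
    walk (suc q) {x} {x′} t i<k k≤j E≡0 inv (y , s , acc) with ℕₚ.m≤n⇒m<n∨m≡n (s≤s⁻¹ i<k)
    ... | inj₂ refl =
      let c′≤1 = ℕₚ.≤-trans at-i′ (ℕₚ.≤-reflexive G≡1)
          y′ , s′ = step-exists x′ (ℕₚ.≤-<-trans c′≤1 (proj₁ (inv-valid inv)))
      in y′ , s′ , accept-⊴ q (inv-end c′≤1 (subst (λ l → Step l x y) (trans at-i A≡0) s) s′ inv) early acc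
    ... | inj₁ i<q with upper⊎lower i<q k≤j
    ...   | inj₁ (_ , up) = contradiction (trans (sym up) E≡0) λ ()
    ...   | inj₂ (c≥ , same-E) =
      let c≡2 = ℕₚ.≤-antisym (s≤s⁻¹ (ℕₚ.<-≤-trans (step-valid s) t))
                  (ℕₚ.≤-trans (s≤s (ℕₚ.≤-trans (ℕₚ.≤-reflexive (sym G≡1)) (ℕₚ.m≤m+n G (E q)))) c≥)
          s₂ = subst (λ l → Step l x y) c≡2 s
          y′ , s′ = step-exists x′ (proj₂ (inv-valid inv) (step-valid s₂))
      in y′ , subst (λ l → Step l x′ y′) (sym (trans (between i<q k≤j) c≡2)) s′ ,
         walk q (three-row-step t s) i<q (ℕₚ.<⇒≤ k≤j)
           (trans (sym same-E) E≡0) (inv-step t s₂ s′ inv) acc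

  -- If `A = G`, no code rises. Otherwise `c j = suc (G + E j) ≤ 2` forces `A = 0`, `G = 1` and
  -- `E j = 0`. Then `c j = 2`, `c′ j = 0`, every code in between is 2, `c i = 0` and `c′ i ≤ 1`.
  exchange-accept : ∀ {x} → ThreeRow x → Accept c (suc j) x → Accept c′ (suc j) x
  exchange-accept {x} t acc₀@(y , s , acc) with ℕₚ.m≤n⇒m<n∨m≡n A≤G
  ... | inj₂ A≡G = accept-⊴ (suc j) {x} {x} (λ _ → ℕₚ.≤-refl) smaller acc₀
    where
    smaller : ∀ {q} → q < suc j → c′ q ≤ c q
    smaller {q} q≤j with ℕₚ.<-cmp q i | ℕₚ.m≤n⇒m<n∨m≡n (s≤s⁻¹ q≤j)
    ... | tri< q<i _ _  | _         = early q<i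
    ... | tri≈ _ refl _ | _         = ℕₚ.≤-trans at-i′ (ℕₚ.≤-reflexive (sym (trans at-i A≡G)))
    ... | tri> _ _ i<q  | inj₁ q<j  = ℕₚ.≤-reflexive (between i<q q<j)
    ... | tri> _ _ _    | inj₂ refl = at-j-≤
  ... | inj₁ A<G =
    let G+E≤1 = s≤s⁻¹ (s≤s⁻¹ (subst (_< 3) at-j (ℕₚ.<-≤-trans (step-valid s) t)))
        G≡1   = ℕₚ.≤-antisym (ℕₚ.≤-trans (ℕₚ.m≤m+n G _) G+E≤1) (ℕₚ.≤-trans (s≤s z≤n) A<G)
        E≡0   = ℕₚ.n≤0⇒n≡0 (s≤s⁻¹ (subst (λ g → g + E j ≤ 1) G≡1 G+E≤1))
        A≡0   = ℕₚ.n≤0⇒n≡0 (s≤s⁻¹ (subst (A <_) G≡1 A<G))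
        c≡2   = trans at-j (cong suc (cong₂ _+_ G≡1 E≡0))
        c′≡0  = ℕₚ.n≤0⇒n≡0 (ℕₚ.≤-trans at-j′ (ℕₚ.≤-reflexive (cong₂ _+_ A≡0 E≡0)))
        y′ , s′ = step-exists x (ℕₚ.≤-<-trans at-j-≤ (step-valid s))
    in y′ , s′ , walk A≡0 G≡1 j (three-row-step t s) i<j ℕₚ.≤-refl E≡0
         (inv-start t (subst (λ l → Step l x y) c≡2 s) (subst (λ l → Step l x y′) c′≡0 s′)) acc

-- Codes under the exchange of an inversion

larger : (ℕ → ℕ) → ℕ → ℕ → ℕ
larger a t k = ♯ (λ p → t ℕₚ.<? a p) (downFrom k)

code : (ℕ → ℕ) → ℕ → ℕ
code a q = larger a (a q) q

-- b is the one-line notation a with the inversion at positions i < j undone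
record Swap (i j : ℕ) (a b : ℕ → ℕ) : Set where
  field
    i<j   : i < j
    inv   : a j < a i
    b-i   : b i ≡ a j
    b-j   : b j ≡ a i
    b-fix : ∀ {p} → p ≢ i → p ≢ j → b p ≡ a p

module _ {i j a b} (sw : Swap i j a b) where
  open Swap sw

  -- Both exchanged positions lie below `q`, so interchanging them matches the counted positions;
  -- `R` is the graph of that interchange.
  swap-above : ∀ {q} → j < q → code b q ≤ code a q
  swap-above {q} j<q = ♯-injection (λ p → b q ℕₚ.<? b p) (λ p → a q ℕₚ.<? a p) R
    (Unique.downFrom⁺ q) total λ _ _ _ _ → R-injective
    where
    data R : ℕ → ℕ → Set where
      ij  : R i j
      ji  : R j i
      fix : ∀ {p} → p ≢ i → p ≢ j → R p p

    R-injective : ∀ {x x′ y} → R x y → R x′ y → x ≡ x′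
    R-injective ij ij = refl
    R-injective ij (fix _ ≢j) = contradiction refl ≢j
    R-injective ji ji = refl
    R-injective ij ji = refl
    R-injective ji ij = refl
    R-injective ji (fix ≢i _) = contradiction refl ≢i
    R-injective (fix _ ≢j) ij = contradiction refl ≢j
    R-injective (fix ≢i _) ji = contradiction refl ≢i
    R-injective (fix _ _) (fix _ _) = refl

    b-q : b q ≡ a q
    b-q = b-fix (ℕₚ.>⇒≢ (ℕₚ.<-trans i<j j<q)) (ℕₚ.>⇒≢ j<q)

    total : ∀ {p} → p ∈ downFrom q → b q < b p → ∃ λ p′ → p′ ∈ downFrom q × a q < a p′ × R p p′
    total {p} p∈ l with p ℕₚ.≟ i | p ℕₚ.≟ j
    ... | yes refl | _ = j , ∈-downFrom⁺ j<q , subst₂ _<_ b-q b-i l , ij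
    ... | no _ | yes refl = i , ∈-downFrom⁺ (ℕₚ.<-trans i<j j<q) , subst₂ _<_ b-q b-j l , ji
    ... | no ≢i | no ≢j = p , p∈ , subst₂ _<_ b-q (b-fix ≢i ≢j) l , fix ≢i ≢j

  module _ (a-injective : Injective _≡_ _≡_ a)
           (cover : ∀ {p} → i < p → p < j → a j < a p → a i < a p) where

    private
      A G : ℕ
      A = larger a (a i) i
      G = larger a (a j) i

      E : ℕ → ℕ
      E q = ♯ (λ p → (i ℕₚ.<? p) ×-dec (a j ℕₚ.<? a p)) (downFrom q)

      larger-a-j : ∀ {q} → i < q → larger a (a j) q ≡ suc (G + E q)
      larger-a-j {q} i<q = trans (♯-split (λ p → a j ℕₚ.<? a p) i i<q)
        (cong (_+ E q) (♯-accept (λ p → a j ℕₚ.<? a p) (downFrom i) inv))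

      larger-a-i : ∀ {q} → i < q → larger a (a i) q ≤ A + E q
      larger-a-i {q} i<q = ℕₚ.≤-trans (ℕₚ.≤-reflexive (♯-split (λ p → a i ℕₚ.<? a p) i i<q))
        (ℕₚ.+-mono-≤ (ℕₚ.≤-reflexive (♯-reject (λ p → a i ℕₚ.<? a p) (downFrom i) (ℕₚ.<-irrefl refl)))
          (♯-mono (λ p → (i ℕₚ.<? p) ×-dec (a i ℕₚ.<? a p)) (λ p → (i ℕₚ.<? p) ×-dec (a j ℕₚ.<? a p))
            (downFrom q) λ _ → map₂ (ℕₚ.<-trans inv)))

      b-low : ∀ {p} → p < i → b p ≡ a p
      b-low p<i = b-fix (ℕₚ.<⇒≢ p<i) (ℕₚ.<⇒≢ (ℕₚ.<-trans p<i i<j))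

      b-mid : ∀ {p} → i < p → p < j → b p ≡ a p
      b-mid i<p p<j = b-fix (ℕₚ.>⇒≢ i<p) (ℕₚ.<⇒≢ p<j)

      in-b : ∀ {t p} → p < j → t < b p → t < a p
      in-b {t} {p} p<j l with p ℕₚ.≟ i
      ... | yes refl = ℕₚ.<-trans (subst (t <_) b-i l) inv
      ... | no  ≢i   = subst (t <_) (b-fix ≢i (ℕₚ.<⇒≢ p<j)) l

      between′ : ∀ {q} → i < q → q < j → code b q ≡ code a q
      between′ {q} i<q q<j = ♯-cong (λ p → b q ℕₚ.<? b p) (λ p → a q ℕₚ.<? a p) (downFrom q) to from
        where
        to : ∀ {p} → p ∈ downFrom q → b q < b p → a q < a p
        to p∈ l = in-b (ℕₚ.<-trans (∈-downFrom⁻ p∈) q<j) (subst (_< _) (b-mid i<q q<j) l)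

        from : ∀ {p} → p ∈ downFrom q → a q < a p → b q < b p
        from {p} p∈ l with p ℕₚ.≟ i
        ... | no  ≢i   = subst₂ _<_ (sym (b-mid i<q q<j))
                           (sym (b-fix ≢i (ℕₚ.<⇒≢ (ℕₚ.<-trans (∈-downFrom⁻ p∈) q<j)))) l
        -- Position `i` is the only one below `j` whose value drops, from `a i` to `a j`; the cover
        -- condition keeps `a q` from lying between the two.
        ... | yes refl = subst₂ _<_ (sym (b-mid i<q q<j)) (sym b-i) (ℕₚ.≰⇒> λ aj≤aq →
            ℕₚ.<-asym l (cover i<q q<j (ℕₚ.≤∧≢⇒< aj≤aq (ℕₚ.>⇒≢ q<j ∘ a-injective))))

    swap-exchange : Exchange i j (code a) (code b)
    swap-exchange = record
      { i<j     = i<j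
      ; A       = A
      ; G       = G
      ; E       = E
      ; A≤G     = ♯-mono (λ p → a i ℕₚ.<? a p) (λ p → a j ℕₚ.<? a p) (downFrom i) λ _ → ℕₚ.<-trans inv
      ; E-start = E-start
      ; at-j    = larger-a-j i<j
      ; at-j′   = ℕₚ.≤-trans (♯-mono (λ p → b j ℕₚ.<? b p) (λ p → a i ℕₚ.<? a p) (downFrom j)
                    λ p∈ l → in-b (∈-downFrom⁻ p∈) (subst (_< _) b-j l)) (larger-a-i i<j)
      ; between = between′
      ; upper⊎lower = upper⊎lower
      ; at-i    = refl
      ; at-i′   = ♯-mono (λ p → b i ℕₚ.<? b p) (λ p → a j ℕₚ.<? a p) (downFrom i)
                    λ p∈ l → subst₂ _<_ b-i (b-low (∈-downFrom⁻ p∈)) l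
      ; early   = λ {q} q<i → ♯-mono (λ p → b q ℕₚ.<? b p) (λ p → a q ℕₚ.<? a p) (downFrom q)
                    λ p∈ l → subst₂ _<_ (b-low q<i) (b-low (ℕₚ.<-trans (∈-downFrom⁻ p∈) q<i)) l
      }
      where
      F? : Decidable (λ p → i < p × a j < a p)
      F? p = (i ℕₚ.<? p) ×-dec (a j ℕₚ.<? a p)

      E-start : E (suc i) ≡ 0
      E-start = ℕₚ.+-cancelˡ-≡ (suc G) _ _ (trans (sym (larger-a-j ℕₚ.≤-refl))
        (trans (♯-accept (λ p → a j ℕₚ.<? a p) (downFrom i) inv) (cong suc (sym (ℕₚ.+-identityʳ G)))))

      upper⊎lower : ∀ {q} → i < q → q < j →
        (code a q ≤ A + E q × E (suc q) ≡ suc (E q)) ⊎ (suc (G + E q) ≤ code a q × E (suc q) ≡ E q)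
      upper⊎lower {q} i<q q<j with ℕₚ.<-cmp (a j) (a q)
      ... | tri< aj<aq _ _ = inj₁
        ( ℕₚ.≤-trans (♯-mono (λ p → a q ℕₚ.<? a p) (λ p → a i ℕₚ.<? a p) (downFrom q)
                       λ _ → ℕₚ.<-trans (cover i<q q<j aj<aq)) (larger-a-i i<q)
        , ♯-accept F? (downFrom q) (i<q , aj<aq))
      ... | tri≈ _ aj≡aq _ = contradiction (a-injective aj≡aq) (ℕₚ.>⇒≢ q<j)
      ... | tri> aj≮aq _ aq<aj = inj₂
        ( ℕₚ.≤-trans (ℕₚ.≤-reflexive (sym (larger-a-j i<q)))
            (♯-mono (λ p → a j ℕₚ.<? a p) (λ p → a q ℕₚ.<? a p) (downFrom q) λ _ → ℕₚ.<-trans aq<aj)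
        , ♯-reject F? (downFrom q) (aj≮aq ∘ proj₂))

-- From covers to arbitrary inversions

Shape : ∀ {R} → State {R} → Set
Shape x = ThreeRow x ⊎ TwoColumn x

shape-step : ∀ {R l} {x y : State {R}} → Shape x → Step l x y → Shape y
shape-step (inj₁ t) s = inj₁ (three-row-step t s)
shape-step (inj₂ t) s = inj₂ (two-column-step t s)

-- The processes may separate already before reaching `j`. The induction stays on `y`, the shape
-- reached by `c`, so that `base` starts from one common shape; `accept-⊴` then carries acceptance
-- over to `y′`.
accept-later : ∀ {R j} {c c′ : ℕ → ℕ} → (∀ {q} → j < q → c′ q ≤ c q) →
  (∀ {x : State {R}} → Shape x → Accept c (suc j) x → Accept c′ (suc j) x) →
  ∀ k {x : State {R}} → j < k → Shape x → Accept c k x → Accept c′ k x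
accept-later later base (suc k) {x} j<k σ (y , s , ac) with ℕₚ.m≤n⇒m<n∨m≡n (s≤s⁻¹ j<k)
... | inj₂ refl = base σ (y , s , ac)
... | inj₁ j<k′ =
  let y′ , s′ = step-exists x (ℕₚ.≤-<-trans (later j<k′) (step-valid s))
  in y′ , s′ , accept-⊴ k (step-⊴ {x = x} {y = x} (λ _ → ℕₚ.≤-refl) (later j<k′) s s′) (λ _ → ℕₚ.≤-refl)
       (accept-later later base k j<k′ (shape-step σ s) ac)

τ : ℕ → ℕ → ℕ → ℕ
τ i j k with k ℕₚ.≟ i | k ℕₚ.≟ j
... | yes _ | _     = j
... | no _  | yes _ = i
... | no _  | no _  = k

τ-left : ∀ i j → τ i j i ≡ j
τ-left i j with i ℕₚ.≟ i
... | yes _  = refl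
... | no i≢i = contradiction refl i≢i

τ-right : ∀ i j → τ i j j ≡ i
τ-right i j with j ℕₚ.≟ i | j ℕₚ.≟ j
... | yes j≡i | _      = j≡i
... | no _    | yes _  = refl
... | no _    | no j≢j = contradiction refl j≢j

τ-fix : ∀ {i j k} → k ≢ i → k ≢ j → τ i j k ≡ k
τ-fix {i} {j} {k} k≢i k≢j with k ℕₚ.≟ i | k ℕₚ.≟ j
... | yes k≡i | _       = contradiction k≡i k≢i
... | no _    | yes k≡j = contradiction k≡j k≢j
... | no _    | no _    = refl

τ-involutive : ∀ i j k → τ i j (τ i j k) ≡ k
τ-involutive i j k with k ℕₚ.≟ i | k ℕₚ.≟ j
... | yes refl | _        = τ-right i j
... | no _     | yes refl = τ-left i j
... | no k≢i   | no k≢j   = τ-fix k≢i k≢j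

τ-injective : ∀ i j → Injective _≡_ _≡_ (τ i j)
τ-injective i j {x} {y} eq = trans (sym (τ-involutive i j x)) (trans (cong (τ i j) eq) (τ-involutive i j y))

swap-τ : ∀ {i j a} → i < j → a j < a i → Swap i j a (a ∘ τ i j)
swap-τ {i} {j} {a} i<j aj<ai = record
  { i<j   = i<j
  ; inv   = aj<ai
  ; b-i   = cong a (τ-left i j)
  ; b-j   = cong a (τ-right i j)
  ; b-fix = λ p≢i p≢j → cong a (τ-fix p≢i p≢j)
  }

-- A non-covering swap a b c → c b a factors into the shorter swaps
-- a b c → b a c → b c a → c b a.
swap-accept : ∀ {R k i j a b} {x : State {R}} → Injective _≡_ _≡_ a → Swap i j a b → j < k →
  Shape x → Accept (code a) k x → Accept (code b) k x
swap-accept {R} {k} {x = x} inj sw j<k σ = go (<-wellFounded _) inj sw j<k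
  where
  go : ∀ {i j a b} → Acc _<_ (j ∸ i) → Injective _≡_ _≡_ a → Swap i j a b → j < k →
       Accept (code a) k x → Accept (code b) k x
  go {i} {j} {a} {b} (WF.acc rec) a-injective sw j<k
    with ℕₚ.anyUpTo? (λ p → (i ℕₚ.<? p) ×-dec ((a j ℕₚ.<? a p) ×-dec (a p ℕₚ.<? a i))) j
  ... | no none = accept-later (swap-above sw) base k j<k σ
    where
    cover : ∀ {p} → i < p → p < j → a j < a p → a i < a p
    cover {p} i<p p<j aj<ap with ℕₚ.<-cmp (a p) (a i)
    ... | tri< ap<ai _ _ = contradiction (p , p<j , i<p , aj<ap , ap<ai) none
    ... | tri≈ _ ap≡ai _ = contradiction (a-injective ap≡ai) (ℕₚ.>⇒≢ i<p)
    ... | tri> _ _ ai<ap = ai<ap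

    base : ∀ {x : State {R}} → Shape x → Accept (code a) (suc j) x → Accept (code b) (suc j) x
    base (inj₁ t) = ThreeRows.exchange-accept R (swap-exchange sw a-injective cover) t
    base (inj₂ t) = TwoColumns.exchange-accept R (swap-exchange sw a-injective cover) t
  ... | yes (p , p<j , i<p , aj<ap , ap<ai) =
    go (rec (ℕₚ.∸-monoˡ-< p<j (ℕₚ.<⇒≤ i<p))) (τ-injective p j ∘ τ-injective i p ∘ a-injective) sw₃ p<k
    ∘ go (rec (ℕₚ.∸-monoʳ-< i<p (ℕₚ.<⇒≤ p<j))) (τ-injective i p ∘ a-injective) (swap-τ p<j a₁j<a₁p) j<k
    ∘ go (rec (ℕₚ.∸-monoˡ-< p<j (ℕₚ.<⇒≤ i<p))) a-injective (swap-τ i<p ap<ai) p<k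
    where
    open Swap sw
    p<k = ℕₚ.<-trans p<j j<k

    a₁ a₂ : ℕ → ℕ
    a₁ = a ∘ τ i p
    a₂ = a₁ ∘ τ p j

    a₁i : a₁ i ≡ a p
    a₁i = cong a (τ-left i p)

    a₁p : a₁ p ≡ a i
    a₁p = cong a (τ-right i p)

    a₁j : a₁ j ≡ a j
    a₁j = cong a (τ-fix (ℕₚ.>⇒≢ i<j) (ℕₚ.>⇒≢ p<j))

    a₁j<a₁p : a₁ j < a₁ p
    a₁j<a₁p = subst₂ _<_ (sym a₁j) (sym a₁p) inv

    a₂i : a₂ i ≡ a p
    a₂i = trans (cong a₁ (τ-fix (ℕₚ.<⇒≢ i<p) (ℕₚ.<⇒≢ i<j))) a₁i

    a₂p : a₂ p ≡ a j
    a₂p = trans (cong a₁ (τ-left p j)) a₁j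

    a₂j : a₂ j ≡ a i
    a₂j = trans (cong a₁ (τ-right p j)) a₁p

    fix₃ : ∀ {q} → q ≢ i → q ≢ p → b q ≡ a₂ q
    fix₃ {q} q≢i q≢p = cases (q ℕₚ.≟ j)
      where
      cases : Dec (q ≡ j) → b q ≡ a₂ q
      cases (yes q≡j) = trans (cong b q≡j) (trans b-j (trans (sym a₂j) (cong a₂ (sym q≡j))))
      cases (no  q≢j) = trans (b-fix q≢i q≢j)
        (sym (trans (cong a₁ (τ-fix q≢p q≢j)) (cong a (τ-fix q≢i q≢p))))

    sw₃ : Swap i p a₂ b
    sw₃ = record
      { i<j   = i<p
      ; inv   = subst₂ _<_ (sym a₂p) (sym a₂i) aj<ap
      ; b-i   = trans b-i (sym a₂p)
      ; b-j   = trans (b-fix (ℕₚ.>⇒≢ i<p) (ℕₚ.<⇒≢ p<j)) (sym a₂i)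
      ; b-fix = fix₃
      }

-- Permutations of Fin n as maps on ℕ

-- One-line notation, extended by the identity so that it is injective on ℕ.
opaque
  line : Permutation′ n → ℕ → ℕ
  line {n} w k with k ℕₚ.<? n
  ... | yes k<n = toℕ (w ⟨$⟩ʳ fromℕ< k<n)
  ... | no  _   = k

  line-toℕ : (w : Permutation′ n) (i : Fin n) → line w (toℕ i) ≡ toℕ (w ⟨$⟩ʳ i)
  line-toℕ {n} w i with toℕ i ℕₚ.<? n
  ... | yes i<n = cong (toℕ ∘ (w ⟨$⟩ʳ_)) (Finₚ.fromℕ<-toℕ i i<n)
  ... | no  i≮n = contradiction (Finₚ.toℕ<n i) i≮n

  line-≥ : (w : Permutation′ n) {k : ℕ} → n ≤ k → line w k ≡ k
  line-≥ {n} w {k} n≤k with k ℕₚ.<? n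
  ... | yes k<n = contradiction k<n (ℕₚ.≤⇒≯ n≤k)
  ... | no  _   = refl

data View (n : ℕ) : ℕ → Set where
  inside  : (i : Fin n) → View n (toℕ i)
  outside : ∀ {k} → n ≤ k → View n k

view : ∀ n k → View n k
view n k with k ℕₚ.<? n
... | yes k<n = subst (View n) (Finₚ.toℕ-fromℕ< k<n) (inside (fromℕ< k<n))
... | no  k≮n = outside (ℕₚ.≮⇒≥ k≮n)

line-cong : {v w : Permutation′ n} → v ≈ w → ∀ k → line v k ≡ line w k
line-cong {n} {v} {w} v≈w k with view n k
... | inside i    = trans (line-toℕ v i) (trans (cong toℕ (v≈w i)) (sym (line-toℕ w i)))
... | outside n≤k = trans (line-≥ v n≤k) (sym (line-≥ w n≤k))

line-reflects : {v w : Permutation′ n} → (∀ k → line v k ≡ line w k) → v ≈ w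
line-reflects {v = v} {w} eq i = Finₚ.toℕ-injective
  (trans (sym (line-toℕ v i)) (trans (eq (toℕ i)) (line-toℕ w i)))

line-· : (σ ρ : Permutation′ n) → ∀ k → line (σ · ρ) k ≡ line σ (line ρ k)
line-· {n} σ ρ k with view n k
... | inside i    = trans (line-toℕ (σ · ρ) i)
                      (sym (trans (cong (line σ) (line-toℕ ρ i)) (line-toℕ σ _)))
... | outside n≤k = trans (line-≥ (σ · ρ) n≤k) (sym (trans (cong (line σ) (line-≥ ρ n≤k)) (line-≥ σ n≤k)))

line-id : ∀ k → line {n} Perm.id k ≡ k
line-id {n} k with view n k
... | inside i    = line-toℕ Perm.id i
... | outside n≤k = line-≥ Perm.id n≤k

line-flip : (w : Permutation′ n) → ∀ k → line (flip w) (line w k) ≡ k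
line-flip {n} w k = trans (sym (line-· (flip w) w k))
  (trans (line-cong {v = flip w · w} {Perm.id} (λ _ → Perm.inverseˡ w) k) (line-id {n} k))

line-injective : (w : Permutation′ n) → Injective _≡_ _≡_ (line w)
line-injective w {j} {k} eq = trans (sym (line-flip w j)) (trans (cong (line (flip w)) eq) (line-flip w k))

line-transpose : (i j : Fin n) → ∀ k → line (transpose i j) k ≡ τ (toℕ i) (toℕ j) k
line-transpose {n} i j k with view n k
... | outside n≤k = trans (line-≥ (transpose i j) n≤k) (sym (τ-fix
        (ℕₚ.>⇒≢ (ℕₚ.<-≤-trans (Finₚ.toℕ<n i) n≤k)) (ℕₚ.>⇒≢ (ℕₚ.<-≤-trans (Finₚ.toℕ<n j) n≤k))))
... | inside l = trans (line-toℕ (transpose i j) l) (cases (l Finₚ.≟ i) (l Finₚ.≟ j))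
  where
  cases : Dec (l ≡ i) → Dec (l ≡ j) → toℕ (transpose i j ⟨$⟩ʳ l) ≡ τ (toℕ i) (toℕ j) (toℕ l)
  cases (yes refl) _ = trans (cong toℕ (transpose-left l j)) (sym (τ-left (toℕ l) (toℕ j)))
    where
    transpose-left : ∀ {n} (i j : Fin n) → transpose i j ⟨$⟩ʳ i ≡ j
    transpose-left i j with i Finₚ.≟ i
    ... | yes _  = refl
    ... | no i≢i = contradiction refl i≢i
  cases (no _) (yes refl) = trans (cong toℕ (transpose-right i l)) (sym (τ-right (toℕ i) (toℕ l)))
    where
    transpose-right : ∀ {n} (i j : Fin n) → transpose i j ⟨$⟩ʳ j ≡ i
    transpose-right i j with j Finₚ.≟ i
    ... | yes j≡i = j≡i
    ... | no _ with j Finₚ.≟ j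
    ...   | yes _  = refl
    ...   | no j≢j = contradiction refl j≢j
  cases (no l≢i) (no l≢j) = trans (cong toℕ transpose-fix)
    (sym (τ-fix (l≢i ∘ Finₚ.toℕ-injective) (l≢j ∘ Finₚ.toℕ-injective)))
    where
    transpose-fix : transpose i j ⟨$⟩ʳ l ≡ l
    transpose-fix with l Finₚ.≟ i
    ... | yes l≡i = contradiction l≡i l≢i
    ... | no _ with l Finₚ.≟ j
    ...   | yes l≡j = contradiction l≡j l≢j
    ...   | no _    = refl

line-s : ∀ {m} (k : Fin m) → ∀ x → line (s {suc m} k) x ≡ τ (toℕ k) (suc (toℕ k)) x
line-s k x = trans (line-transpose (inject₁ k) (suc k) x)
  (cong (λ l → τ l (suc (toℕ k)) x) (Finₚ.toℕ-inject₁ k))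

-- Identifies the letter to delete in `strong-exchange`: when a letter inverts a pair, the values it
-- interchanges are exactly those of the pair.
τ-inverts⇒adjacent : ∀ {k x y} → x < y → τ k (suc k) y < τ k (suc k) x → x ≡ k × y ≡ suc k
τ-inverts⇒adjacent {k} {x} {y} x<y inv
  with x ℕₚ.≟ k | x ℕₚ.≟ suc k | y ℕₚ.≟ k | y ℕₚ.≟ suc k
... | yes refl | _        | _        | yes refl = refl , refl
... | yes refl | _        | yes refl | no _     = contradiction x<y (ℕₚ.<-irrefl refl)
... | yes refl | _        | no _     | no _     = contradiction (s≤s⁻¹ inv) (ℕₚ.<⇒≱ x<y)
... | no _     | yes refl | yes refl | _        = contradiction x<y (ℕₚ.≤⇒≯ (ℕₚ.n≤1+n _))
... | no _     | yes refl | no _     | yes refl = contradiction x<y (ℕₚ.<-irrefl refl)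
... | no _     | yes refl | no _     | no _     = contradiction x<y (ℕₚ.<⇒≯ (ℕₚ.m<n⇒m<1+n inv))
... | no _     | no _     | yes refl | _        = contradiction x<y (ℕₚ.<⇒≯ (ℕₚ.<-trans (ℕₚ.n<1+n _) inv))
... | no _     | no x≢    | no _     | yes refl = contradiction (s≤s⁻¹ x<y) (ℕₚ.<⇒≱ inv)
... | no _     | no _     | no _     | no _     = contradiction x<y (ℕₚ.<⇒≯ inv)

-- Bruhat edges and the exchange property

·-transpose : (u : Permutation′ n) (i j : Fin n) → ∀ x →
  line (u · transpose i j) x ≡ line u (τ (toℕ i) (toℕ j) x)
·-transpose u i j x = trans (line-· u (transpose i j) x) (cong (line u) (line-transpose i j x))

-- Reading the word from the right, the pair (i, j) becomes inverted at some letter; deleting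
-- that letter multiplies by the transposition.
strong-exchange : ∀ {n} (is : Word n) {i j : Fin n} → i Fin.< j →
  line (⟦_⟧ {n} is) (toℕ j) < line (⟦_⟧ {n} is) (toℕ i) →
  ∃ λ (is′ : Word n) → length is′ < length is × ⟦_⟧ {n} is′ ≈ ⟦_⟧ {n} is · transpose i j
strong-exchange {n} [] {i} {j} i<j inv =
  contradiction (subst₂ _<_ (line-id {n} (toℕ j)) (line-id {n} (toℕ i)) inv) (ℕₚ.<⇒≯ i<j)
strong-exchange {suc m} (k ∷ is) {i} {j} i<j inv = cases (ℕₚ.<-cmp (u (toℕ i)) (u (toℕ j)))
  where
  σ = ⟦_⟧ {suc m} is
  σ′ = ⟦_⟧ {suc m} (k ∷ is)

  u : ℕ → ℕ
  u = line σ

  read : ∀ x → line σ′ x ≡ τ (toℕ k) (suc (toℕ k)) (u x)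
  read x = trans (line-· (s k) σ x) (line-s k (u x))

  module _ (ui≡k : u (toℕ i) ≡ toℕ k) (uj≡sk : u (toℕ j) ≡ suc (toℕ k)) where

    undo : ∀ x → Dec (x ≡ toℕ i) → Dec (x ≡ toℕ j) →
      τ (toℕ k) (suc (toℕ k)) (u (τ (toℕ i) (toℕ j) x)) ≡ u x
    undo _ (yes refl) _ = trans (cong (τ _ _ ∘ u) (τ-left (toℕ i) (toℕ j)))
      (trans (cong (τ _ _) uj≡sk) (trans (τ-right (toℕ k) (suc (toℕ k))) (sym ui≡k)))
    undo _ (no _) (yes refl) = trans (cong (τ _ _ ∘ u) (τ-right (toℕ i) (toℕ j)))
      (trans (cong (τ _ _) ui≡k) (trans (τ-left (toℕ k) (suc (toℕ k))) (sym uj≡sk)))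
    undo _ (no x≢i) (no x≢j) = trans (cong (τ _ _ ∘ u) (τ-fix x≢i x≢j)) (τ-fix
      (λ ux≡k → x≢i (line-injective σ (trans ux≡k (sym ui≡k))))
      (λ ux≡sk → x≢j (line-injective σ (trans ux≡sk (sym uj≡sk)))))

  cases : _ → ∃ λ (is′ : Word (suc m)) → length is′ < suc (length is) × ⟦_⟧ {suc m} is′ ≈ σ′ · transpose i j
  cases (tri≈ _ eq _) = contradiction (line-injective σ eq) (ℕₚ.<⇒≢ i<j)
  cases (tri> _ _ uj<ui) =
    let is′ , shorter , eq = strong-exchange is i<j uj<ui
    in k ∷ is′ , s≤s shorter , λ x → cong (s k ⟨$⟩ʳ_) (eq x)
  cases (tri< ui<uj _ _) =
    let ui≡k , uj≡sk = τ-inverts⇒adjacent ui<uj (subst₂ _<_ (read (toℕ j)) (read (toℕ i)) inv)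
    in is , ℕₚ.≤-refl , line-reflects {v = σ} {w = σ′ · transpose i j} λ x → sym (trans
         (·-transpose σ′ i j x) (trans (read (τ (toℕ i) (toℕ j) x))
           (undo ui≡k uj≡sk x (x ℕₚ.≟ toℕ i) (x ℕₚ.≟ toℕ j))))

-- An edge compares lengths, whereas a `Swap` asks for an inversion of `w`. If `v` were inverted at
-- `i < j`, strong exchange applied to a shortest word of `v` would yield a word for `w` shorter
-- than the length of `v`.
edge⇒swap : {v w : Permutation′ n} → v ⟶ w → ∃ λ i → ∃ λ j → j < n × Swap i j (line w) (line v)
edge⇒swap {n} {v} {w} ((i , j , i<j , w≈vt) , (k , l , v-length , w-length , k<l)) =
  toℕ i , toℕ j , Finₚ.toℕ<n j , record
    { i<j   = i<j
    ; inv   = subst₂ _<_ (sym wj) (sym wi) increasing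
    ; b-i   = sym wj
    ; b-j   = sym wi
    ; b-fix = λ {p} p≢i p≢j → sym (trans (line-w p) (cong (line v) (τ-fix p≢i p≢j)))
    }
  where
  line-w : ∀ x → line w x ≡ line v (τ (toℕ i) (toℕ j) x)
  line-w x = trans (line-cong {v = w} {v · transpose i j} w≈vt x) (·-transpose v i j x)

  wi : line w (toℕ i) ≡ line v (toℕ j)
  wi = trans (line-w (toℕ i)) (cong (line v) (τ-left (toℕ i) (toℕ j)))

  wj : line w (toℕ j) ≡ line v (toℕ i)
  wj = trans (line-w (toℕ j)) (cong (line v) (τ-right (toℕ i) (toℕ j)))

  increasing : line v (toℕ i) < line v (toℕ j)
  increasing with HasLength.attained v-length | ℕₚ.<-cmp (line v (toℕ i)) (line v (toℕ j))
  ... | _ | tri< vi<vj _ _ = vi<vj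
  ... | _ | tri≈ _ vi≡vj _ = contradiction (line-injective v vi≡vj) (ℕₚ.<⇒≢ i<j)
  ... | is , is-length , is≈v | tri> _ _ vj<vi =
    let is′ , shorter , eq = strong-exchange is i<j
          (subst₂ _<_ (sym (line-cong {v = ⟦_⟧ {n} is} {v} is≈v (toℕ j)))
            (sym (line-cong {v = ⟦_⟧ {n} is} {v} is≈v (toℕ i))) vj<vi)
        l≤ = HasLength.minimal w-length is′ (λ x → trans (eq x) (trans (is≈v _) (sym (w≈vt x))))
    in contradiction (ℕₚ.≤-<-trans l≤ (subst (length is′ <_) is-length shorter)) (ℕₚ.<⇒≯ k<l)

code-cong : ∀ {a b : ℕ → ℕ} → (∀ k → a k ≡ b k) → ∀ q → code a q ≡ code b q
code-cong {a} {b} a≗b q = ♯-cong (λ p → a q ℕₚ.<? a p) (λ p → b q ℕₚ.<? b p) (downFrom q)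
  (λ {p} _ → subst₂ _<_ (a≗b q) (a≗b p)) (λ {p} _ → subst₂ _<_ (sym (a≗b q)) (sym (a≗b p)))

accept-cong : ∀ {R k} {c c′ : ℕ → ℕ} {x : State {R}} → (∀ {q} → q < k → c q ≡ c′ q) →
  Accept c k x → Accept c′ k x
accept-cong {k = k} {x = x} c≗c′ =
  accept-⊴ k {x} {x} (λ _ → ℕₚ.≤-refl) (λ q<k → ℕₚ.≤-reflexive (sym (c≗c′ q<k)))

bruhat-accept : ∀ {R} {x : State {R}} {v w : Permutation′ n} → Shape x → v ≤ᴮ w →
  Accept (code (line w)) n x → Accept (code (line v)) n x
bruhat-accept {v = v} {w} σ (reflexive v≈w) ac =
  accept-cong (λ {q} _ → code-cong (λ k → sym (line-cong {v = v} {w} v≈w k)) q) ac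
bruhat-accept σ (step {v} {u} {w} v⟶u u≤w) ac =
  let i , j , j<n , sw = edge⇒swap {v = v} {u} v⟶u
  in swap-accept (line-injective u) sw j<n σ (bruhat-accept σ u≤w ac)

-- Downward induction on positions. Once all later values agree, the same values remain for both
-- permutations, and the smaller choice has more of them above it.
code-injective : (v w : Permutation′ n) → (∀ {q} → q < n → code (line v) q ≡ code (line w) q) → v ≈ w
code-injective {n} v w same = line-reflects {v = v} {w} (λ k → agree n n≤⇒ k)
  where
  n≤⇒ : ∀ {k} → n ≤ k → line v k ≡ line w k
  n≤⇒ n≤k = trans (line-≥ v n≤k) (sym (line-≥ w n≤k))

  absurd : ∀ {q} (a b : Permutation′ n) → (∀ {k} → q < k → line a k ≡ line b k) →
    line a q < line b q → code (line b) q < code (line a) q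
  absurd {q} a b above aq<bq = ℕₚ.≤-trans
    (ℕₚ.≤-trans
      -- The weak inequality also counts `q` itself, which yields strictness. Each counted `p` is
      -- then sent to the position where `a` takes the value `line b p`, and that position is below
      -- `q`.
      (s≤s (♯-mono (λ p → line b q ℕₚ.<? line b p) (λ p → line b q ℕₚ.≤? line b p) (downFrom q) λ _ → ℕₚ.<⇒≤))
      (ℕₚ.≤-reflexive (sym (♯-accept (λ p → line b q ℕₚ.≤? line b p) {q} (downFrom q) ℕₚ.≤-refl))))
    (♯-injection (λ p → line b q ℕₚ.≤? line b p) (λ p → line a q ℕₚ.<? line a p) (λ p p′ → line a p′ ≡ line b p)
      (Unique.downFrom⁺ (suc q)) total
      λ _ _ _ _ Rx Rx′ → line-injective b (trans (sym Rx) Rx′))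
    where
    preimage : ∀ p → line a (line (flip a) (line b p)) ≡ line b p
    preimage p = line-flip (flip a) (line b p)

    total : ∀ {p} → p ∈ downFrom (suc q) → line b q ≤ line b p →
      ∃ λ p′ → p′ ∈ downFrom q × line a q < line a p′ × line a p′ ≡ line b p
    total {p} p∈ bq≤bp = p′ , ∈-downFrom⁺ (ℕₚ.≤∧≢⇒< p′≤q p′≢q) , aq<ap′ , preimage p
      where
      p′ : ℕ
      p′ = line (flip a) (line b p)

      aq<ap′ : line a q < line a p′
      aq<ap′ = ℕₚ.<-≤-trans aq<bq (ℕₚ.≤-trans bq≤bp (ℕₚ.≤-reflexive (sym (preimage p))))

      p′≢q : p′ ≢ q
      p′≢q p′≡q = ℕₚ.<-irrefl (cong (line a) (sym p′≡q)) aq<ap′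

      p′≤q : p′ ≤ q
      p′≤q = ℕₚ.≮⇒≥ λ q<p′ → ℕₚ.<⇒≱ q<p′ (subst (_≤ q)
        (line-injective b (trans (sym (preimage p)) (above q<p′))) (s≤s⁻¹ (∈-downFrom⁻ p∈)))

  agree : ∀ m → (∀ {k} → m ≤ k → line v k ≡ line w k) → ∀ k → line v k ≡ line w k
  agree zero    above k = above z≤n
  agree (suc m) above   = agree m above′
    where
    line-m : line v m ≡ line w m
    line-m with view n m
    ... | outside n≤m = n≤⇒ n≤m
    ... | inside i    = cases (ℕₚ.<-cmp (line v m) (line w m))
      where
      m<n = Finₚ.toℕ<n i

      cases : _ → line v m ≡ line w m
      cases (tri< l _ _)  = contradiction (sym (same m<n)) (ℕₚ.<⇒≢ (absurd v w above l))
      cases (tri≈ _ eq _) = eq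
      cases (tri> _ _ l)  = contradiction (same m<n) (ℕₚ.<⇒≢ (absurd w v (sym ∘ above) l))

    above′ : ∀ {k} → m ≤ k → line v k ≡ line w k
    above′ m≤k with ℕₚ.m≤n⇒m<n∨m≡n m≤k
    ... | inj₁ m<k  = above m<k
    ... | inj₂ refl = line-m

-- The code of a Schubert point

-- For `t = K ∸ ℓ` this describes the factor w_K of a Schubert point, where `ℓ` counts the pairs of
-- the entry that is `K` from 0 and `suc K` from 1.
record Cycle (t K : ℕ) (f : ℕ → ℕ) : Set where
  field
    top    : f K ≡ t
    shift  : ∀ {a} → t ≤ a → a < K → f a ≡ suc a
    below  : ∀ {a} → a < t → f a ≡ a
    beyond : ∀ {a} → K < a → f a ≡ a

cycle-resp : ∀ {t K f g} → (∀ a → f a ≡ g a) → Cycle t K f → Cycle t K g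
cycle-resp f≗g c = record
  { top    = trans (sym (f≗g _)) top
  ; shift  = λ t≤a a<K → trans (sym (f≗g _)) (shift t≤a a<K)
  ; below  = λ a<t → trans (sym (f≗g _)) (below a<t)
  ; beyond = λ K<a → trans (sym (f≗g _)) (beyond K<a)
  }
  where open Cycle c

cycle-id : ∀ K → Cycle K K id
cycle-id K = record
  { top    = refl
  ; shift  = λ K≤a a<K → contradiction K≤a (ℕₚ.<⇒≱ a<K)
  ; below  = λ _ → refl
  ; beyond = λ _ → refl
  }

cycle-τ : ∀ {t K f} → t ≤ K → Cycle t K f → Cycle t (suc K) (f ∘ τ K (suc K))
cycle-τ {t} {K} {f} t≤K c = record
  { top    = trans (cong f (τ-right K (suc K))) top
  ; shift  = λ {a} t≤a a<1+K → shift′ t≤a (ℕₚ.m≤n⇒m<n∨m≡n (s≤s⁻¹ a<1+K))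
  ; below  = λ a<t → let a<K = ℕₚ.<-≤-trans a<t t≤K in
      trans (cong f (τ-fix (ℕₚ.<⇒≢ a<K) (ℕₚ.<⇒≢ (ℕₚ.m<n⇒m<1+n a<K)))) (below a<t)
  ; beyond = λ 1+K<a → let K<a = ℕₚ.<-trans (ℕₚ.n<1+n K) 1+K<a in
      trans (cong f (τ-fix (ℕₚ.>⇒≢ K<a) (ℕₚ.>⇒≢ 1+K<a))) (beyond K<a)
  }
  where
  open Cycle c

  shift′ : ∀ {a} → t ≤ a → a < K ⊎ a ≡ K → f (τ K (suc K) a) ≡ suc a
  shift′ t≤a (inj₁ a<K) =
    trans (cong f (τ-fix (ℕₚ.<⇒≢ a<K) (ℕₚ.<⇒≢ (ℕₚ.m<n⇒m<1+n a<K)))) (shift t≤a a<K)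
  shift′ t≤a (inj₂ refl) = trans (cong f (τ-left K (suc K))) (beyond (ℕₚ.n<1+n K))

∏-∷ʳ : (ρs : List (Permutation′ n)) (σ : Permutation′ n) → ∀ x → line (∏ (ρs ∷ʳ σ)) x ≡ line (∏ ρs) (line σ x)
∏-∷ʳ {n} [] σ x = trans (line-· σ Perm.id x) (trans (cong (line σ) (line-id {n} x)) (sym (line-id {n} _)))
∏-∷ʳ (ρ ∷ ρs) σ x = trans (line-· ρ (∏ (ρs ∷ʳ σ)) x)
  (trans (cong (line ρ) (∏-∷ʳ ρs σ x)) (sym (line-· ρ (∏ ρs) (line σ x))))

descent-cycle : ∀ {m} (k : Fin m) ℓ → ℓ ≤ suc (toℕ k) →
  Cycle (suc (toℕ k) ∸ ℓ) (suc (toℕ k)) (line (⟦_⟧ {suc m} (descent k ℓ)))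
descent-cycle {m} k zero _ = cycle-resp (λ a → sym (line-id {suc m} a)) (cycle-id (suc (toℕ k)))
descent-cycle {m} k (suc ℓ) 1+ℓ≤ = cycle-resp (λ a → sym (trans (last a) (cong (line σ) (line-s k a))))
  (cycle-τ (ℕₚ.m∸n≤m (toℕ k) ℓ) (previous k ℓ (s≤s⁻¹ 1+ℓ≤)))
  where
  σ = ⟦_⟧ {suc m} (descent (Fin.pred k) ℓ)

  last : ∀ a → line (⟦_⟧ {suc m} (descent (Fin.pred k) ℓ ∷ʳ k)) a ≡ line σ (line (s k) a)
  last a = trans (cong (λ ρs → line (∏ ρs) a) (map-++ s (descent (Fin.pred k) ℓ) (k ∷ [])))
    (∏-∷ʳ (map s (descent (Fin.pred k) ℓ)) (s k) a)

  -- At `zero`, where `Fin.pred` truncates, the bound forces the empty word; elsewhere the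
  -- predecessor is an `inject₁`.
  previous : ∀ {m} (k : Fin m) ℓ → ℓ ≤ toℕ k →
    Cycle (toℕ k ∸ ℓ) (toℕ k) (line (⟦_⟧ {suc m} (descent (Fin.pred k) ℓ)))
  previous {m} zero    zero _ = cycle-resp (λ a → sym (line-id {suc m} a)) (cycle-id 0)
  previous {suc m} (suc k) ℓ ℓ≤ = subst
    (λ l → Cycle (suc l ∸ ℓ) (suc l) (line (⟦_⟧ {suc (suc m)} (descent (inject₁ k) ℓ))))
    (Finₚ.toℕ-inject₁ k)
    (descent-cycle (inject₁ k) ℓ (subst (λ l → ℓ ≤ suc l) (sym (Finₚ.toℕ-inject₁ k)) ℓ≤))

♯-≥ : ∀ t K → ♯ (λ a → t ℕₚ.≤? a) (downFrom K) ≡ K ∸ t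
♯-≥ t zero    = sym (ℕₚ.0∸n≡0 t)
♯-≥ t (suc K) = cases (t ℕₚ.≤? K)
  where
  cases : Dec (t ≤ K) → ♯ (λ a → t ℕₚ.≤? a) (downFrom (suc K)) ≡ suc K ∸ t
  cases (yes t≤K) = trans (♯-accept (λ a → t ℕₚ.≤? a) (downFrom K) t≤K)
    (trans (cong suc (♯-≥ t K)) (sym (ℕₚ.+-∸-assoc 1 t≤K)))
  cases (no  t≰K) = trans (♯-reject (λ a → t ℕₚ.≤? a) (downFrom K) t≰K)
    (trans (♯-≥ t K) (trans (ℕₚ.m≤n⇒m∸n≡0 (ℕₚ.<⇒≤ (ℕₚ.≰⇒> t≰K)))
      (sym (ℕₚ.m≤n⇒m∸n≡0 (ℕₚ.≰⇒> t≰K)))))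

-- a restricts to a permutation of {0, …, K - 1}: the injection bounds the count of every
-- predicate and of its complement, and the two counts add up to K.
♯-reindex : ∀ {P : ℕ → Set} (P? : ∀ x → Dec (P x)) {a : ℕ → ℕ} {K} → Injective _≡_ _≡_ a →
  (∀ {x} → x < K → a x < K) → ♯ (P? ∘ a) (downFrom K) ≡ ♯ P? (downFrom K)
♯-reindex {P} P? {a} {K} a-injective a<K = ℕₚ.≤-antisym (shrink P?)
  (ℕₚ.+-cancelʳ-≤ (♯ (¬? ∘ P? ∘ a) (downFrom K)) _ _ (ℕₚ.≤-trans
    (ℕₚ.+-monoʳ-≤ (♯ P? (downFrom K)) (shrink (¬? ∘ P?)))
    (ℕₚ.≤-reflexive (trans (♯-∁ P? (downFrom K)) (sym (♯-∁ (P? ∘ a) (downFrom K)))))))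
  where
  shrink : ∀ {Q : ℕ → Set} (Q? : ∀ x → Dec (Q x)) → ♯ (Q? ∘ a) (downFrom K) ≤ ♯ Q? (downFrom K)
  shrink Q? = ♯-injection (Q? ∘ a) Q? (λ x y → y ≡ a x) (Unique.downFrom⁺ K)
    (λ {x} x∈ Qax → a x , ∈-downFrom⁺ (a<K (∈-downFrom⁻ x∈)) , Qax , refl)
    (λ _ _ _ _ y≡ax y≡ax′ → a-injective (trans (sym y≡ax) y≡ax′))

record Prefix (ℓ : ℕ → ℕ) (K : ℕ) (a : ℕ → ℕ) : Set where
  field
    fixes : ∀ {p} → K ≤ p → a p ≡ p
    codes : ∀ {q} → q < K → code a q ≡ ℓ q

prefix-resp : ∀ {ℓ K a b} → (∀ x → a x ≡ b x) → Prefix ℓ K a → Prefix ℓ K b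
prefix-resp a≗b p = record
  { fixes = λ K≤p → trans (sym (a≗b _)) (Prefix.fixes p K≤p)
  ; codes = λ {q} q<K → trans (sym (code-cong a≗b q)) (Prefix.codes p q<K)
  }

-- On values below `K` the cycle is increasing and skips `t`, so the earlier codes survive. Position
-- `K` receives `t`, and the values that end up above it come from those in the range from `t` to
-- `K - 1`, which are `ℓ K` in number.
prefix-extend : ∀ {ℓ K a f} → Injective _≡_ _≡_ a → ℓ K ≤ K → Cycle (K ∸ ℓ K) K f →
  Prefix ℓ K a → Prefix ℓ (suc K) (f ∘ a)
prefix-extend {ℓ} {K} {a} {f} a-injective ℓ≤K c p = record
  { fixes = λ K<p → trans (cong f (fixes (ℕₚ.<⇒≤ K<p))) (beyond K<p)
  ; codes = λ q<1+K → codes′ (ℕₚ.m≤n⇒m<n∨m≡n (s≤s⁻¹ q<1+K))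
  }
  where
  open Cycle c
  open Prefix p
  t = K ∸ ℓ K

  a<K : ∀ {x} → x < K → a x < K
  a<K {x} x<K = ℕₚ.≰⇒> λ K≤ax → ℕₚ.<⇒≱ x<K (subst (K ≤_) (a-injective (fixes K≤ax)) K≤ax)

  f≥ : ∀ {x} → x < K → x ≤ f x
  f≥ {x} x<K with t ℕₚ.≤? x
  ... | yes t≤x = ℕₚ.≤-trans (ℕₚ.n≤1+n x) (ℕₚ.≤-reflexive (sym (shift t≤x x<K)))
  ... | no  t≰x = ℕₚ.≤-reflexive (sym (below (ℕₚ.≰⇒> t≰x)))

  f-mono-≤ : ∀ {x y} → x ≤ y → y < K → f x ≤ f y
  f-mono-≤ {x} {y} x≤y y<K with t ℕₚ.≤? x | t ℕₚ.≤? y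
  ... | yes t≤x | yes t≤y = subst₂ _≤_ (sym (shift t≤x (ℕₚ.≤-<-trans x≤y y<K))) (sym (shift t≤y y<K)) (s≤s x≤y)
  ... | yes t≤x | no  t≰y = contradiction (ℕₚ.≤-trans t≤x x≤y) t≰y
  ... | no  t≰x | _       = ℕₚ.≤-trans (ℕₚ.≤-reflexive (below (ℕₚ.≰⇒> t≰x))) (ℕₚ.≤-trans x≤y (f≥ y<K))

  f-mono-< : ∀ {x y} → x < y → y < K → f x < f y
  f-mono-< {x} {y} x<y y<K with t ℕₚ.≤? x
  ... | yes t≤x = subst₂ _<_ (sym (shift t≤x (ℕₚ.<-trans x<y y<K)))
                    (sym (shift (ℕₚ.≤-trans t≤x (ℕₚ.<⇒≤ x<y)) y<K)) (s≤s x<y)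
  ... | no  t≰x = ℕₚ.≤-<-trans (ℕₚ.≤-reflexive (below (ℕₚ.≰⇒> t≰x))) (ℕₚ.<-≤-trans x<y (f≥ y<K))

  above-t : ∀ {x} → x < K → t < f x → t ≤ x
  above-t {x} x<K t<fx with t ℕₚ.≤? x
  ... | yes t≤x = t≤x
  ... | no  t≰x = contradiction (subst (t <_) (below (ℕₚ.≰⇒> t≰x)) t<fx) (ℕₚ.<-asym (ℕₚ.≰⇒> t≰x))

  fa≡t : f (a K) ≡ t
  fa≡t = trans (cong f (fixes ℕₚ.≤-refl)) top

  open ≡-Reasoning

  codes′ : ∀ {q} → q < K ⊎ q ≡ K → code (f ∘ a) q ≡ ℓ q
  codes′ {q} (inj₁ q<K) = trans (♯-cong (λ p → f (a q) ℕₚ.<? f (a p)) (λ p → a q ℕₚ.<? a p) (downFrom q)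
      (λ p∈ l → ℕₚ.≰⇒> λ ap≤aq → ℕₚ.<⇒≱ l (f-mono-≤ ap≤aq (a<K q<K)))
      (λ p∈ l → f-mono-< l (a<K (ℕₚ.<-trans (∈-downFrom⁻ p∈) q<K)))) (codes q<K)
  codes′ (inj₂ refl) = begin
    ♯ (λ p → f (a K) ℕₚ.<? f (a p)) (downFrom K)
      ≡⟨ ♯-cong (λ p → f (a K) ℕₚ.<? f (a p)) (λ p → t ℕₚ.≤? a p) (downFrom K)
           (λ p∈ l → above-t (a<K (∈-downFrom⁻ p∈)) (ℕₚ.≤-<-trans (ℕₚ.≤-reflexive (sym fa≡t)) l))
           (λ p∈ t≤ap → subst₂ _<_ (sym fa≡t) (sym (shift t≤ap (a<K (∈-downFrom⁻ p∈)))) (s≤s t≤ap)) ⟩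
    ♯ (λ p → t ℕₚ.≤? a p) (downFrom K)
      ≡⟨ ♯-reindex (λ x → t ℕₚ.≤? x) a-injective a<K ⟩
    ♯ (λ x → t ℕₚ.≤? x) (downFrom K)
      ≡⟨ ♯-≥ t K ⟩
    K ∸ (K ∸ ℓ K)
      ≡⟨ ℕₚ.m∸[m∸n]≡n ℓ≤K ⟩
    ℓ K ∎

module _ {m : ℕ} (ℓ : ℕ → ℕ) (ℓ≤ : ∀ K → ℓ K ≤ K) (F : Fin m → Permutation′ (suc m))
         (F-cycle : ∀ k → Cycle (suc (toℕ k) ∸ ℓ (suc (toℕ k))) (suc (toℕ k)) (line (F k))) where

  -- Reversal puts `F (g zero)` at the right end of the product, so it acts first; the accumulator
  -- `u` absorbs it.
  prefix-product : ∀ r K (g : Fin r → Fin m) → (∀ i → suc (toℕ (g i)) ≡ K + toℕ i) →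
    (u : Permutation′ (suc m)) → Prefix ℓ K (line u) →
    Prefix ℓ (K + r) (line (∏ (map F (reverse (tabulate g))) · u))
  prefix-product zero K g _ u p = subst (λ N → Prefix ℓ N _) (sym (ℕₚ.+-identityʳ K))
    (prefix-resp (λ x → sym (trans (line-· Perm.id u x) (line-id {suc m} _))) p)
  prefix-product (suc r) K g g≡ u p =
    subst (λ N → Prefix ℓ N (line (∏ (map F (reverse (tabulate g))) · u))) (sym (ℕₚ.+-suc K r))
    (prefix-resp regroup
      (prefix-product r (suc K) (g ∘ suc) (λ i → trans (g≡ (suc i)) (ℕₚ.+-suc K (toℕ i))) (F (g zero) · u)
        (prefix-resp (λ x → sym (line-· (F (g zero)) u x))
          (prefix-extend (line-injective u) (ℓ≤ K)
            (subst (λ N → Cycle (N ∸ ℓ N) N (line (F (g zero))))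
              (trans (g≡ zero) (ℕₚ.+-identityʳ K)) (F-cycle (g zero)))
            p))))
    where
    ρ = tabulate (g ∘ suc)
    w = ∏ (map F (reverse ρ))

    regroup : ∀ x → line (w · (F (g zero) · u)) x ≡ line (∏ (map F (reverse (g zero ∷ ρ))) · u) x
    regroup x = begin
      line (w · (F (g zero) · u)) x ≡⟨ line-· w (F (g zero) · u) x ⟩
      line w (line (F (g zero) · u) x) ≡⟨ cong (line w) (line-· (F (g zero)) u x) ⟩
      line w (line (F (g zero)) (line u x)) ≡⟨ ∏-∷ʳ (map F (reverse ρ)) (F (g zero)) (line u x) ⟨
      line (∏ (map F (reverse ρ) ∷ʳ F (g zero))) (line u x)
        ≡⟨ cong (λ ρs → line (∏ ρs) (line u x)) (trans
             (cong (map F) (unfold-reverse (g zero) ρ)) (map-++ F (reverse ρ) (g zero ∷ []))) ⟨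
      line (∏ (map F (reverse (g zero ∷ ρ)))) (line u x) ≡⟨ line-· (∏ (map F (reverse (g zero ∷ ρ)))) u x ⟨
      line (∏ (map F (reverse (g zero ∷ ρ))) · u) x ∎
      where open ≡-Reasoning

dimensionPairs-≤ : ∀ {μ : Partition n} (T : RowStrictTableau μ) q → dimensionPairs T q ≤ toℕ q
dimensionPairs-≤ {n} T q = ℕₚ.≤-trans
  (♯-injection (λ p → dimensionPair? T p q) (λ _ → yes tt) (λ p k → k ≡ toℕ p)
    {ys = downFrom (toℕ q)} (Unique.allFin⁺ n)
    (λ {p} _ (p<q , _) → toℕ p , ∈-downFrom⁺ p<q , tt , refl)
    (λ _ _ _ _ e e′ → Finₚ.toℕ-injective (trans (sym e) e′)))
  (ℕₚ.≤-reflexive (trans (cong length (filter-all (λ _ → yes tt) {downFrom (toℕ q)} (All.tabulate λ _ → tt)))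
    (length-downFrom (toℕ q))))

code-schubertPoint : ∀ {μ : Partition n} (T : RowStrictTableau μ) q →
  code (line (schubertPoint T)) (toℕ q) ≡ dimensionPairs T q
code-schubertPoint {zero} T ()
code-schubertPoint {suc m} T q = trans
  (Prefix.codes (prefix-resp (λ x → trans (line-· (schubertPoint T) Perm.id x)
      (cong (line (schubertPoint T)) (line-id {suc m} x))) whole) (Finₚ.toℕ<n q))
  (ℓ-toℕ q)
  where
  ℓ : ℕ → ℕ
  ℓ K with K ℕₚ.<? suc m
  ... | yes K<n = dimensionPairs T (fromℕ< K<n)
  ... | no  _   = 0

  ℓ-toℕ : ∀ q → ℓ (toℕ q) ≡ dimensionPairs T q
  ℓ-toℕ q with toℕ q ℕₚ.<? suc m
  ... | yes q<n = cong (dimensionPairs T) (Finₚ.fromℕ<-toℕ q q<n)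
  ... | no  q≮n = contradiction (Finₚ.toℕ<n q) q≮n

  ℓ≤ : ∀ K → ℓ K ≤ K
  ℓ≤ K with K ℕₚ.<? suc m
  ... | yes K<n = ℕₚ.≤-trans (dimensionPairs-≤ T (fromℕ< K<n)) (ℕₚ.≤-reflexive (Finₚ.toℕ-fromℕ< K<n))
  ... | no  _   = z≤n

  factor-cycle : ∀ k → Cycle (suc (toℕ k) ∸ ℓ (suc (toℕ k))) (suc (toℕ k)) (line (factor T k))
  factor-cycle k = subst (λ l → Cycle (suc (toℕ k) ∸ l) (suc (toℕ k)) (line (factor T k)))
    (sym (ℓ-toℕ (suc k)))
    (descent-cycle k (dimensionPairs T (suc k)) (dimensionPairs-≤ T (suc k)))

  whole : Prefix ℓ (suc m) (line (schubertPoint T · Perm.id))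
  -- The smallest entry has code 0 and no factor, so the induction starts from the identity at
  -- `K = 1`.
  whole = prefix-product ℓ ℓ≤ (factor T) factor-cycle m 1 id (λ _ → refl) Perm.id record
    { fixes = λ _ → line-id {suc m} _
    ; codes = λ { {zero} _ → sym (ℕₚ.n≤0⇒n≡0 (ℓ≤ 0)) ; {suc _} (s≤s ()) }
    }

-- Row-strict tableaux

♯-lower : ∀ {m X} {P : Fin m → Set} (P? : ∀ c → Dec (P c)) → X ≤ m →
  (∀ c → toℕ c < X → P c) → X ≤ ♯ P? (allFin m)
♯-lower {m} {X} P? X≤m below = subst (_≤ ♯ P? (allFin m)) (length-downFrom X)
  (unique-length-≤ (λ x c → x ≡ toℕ c) (Unique.downFrom⁺ X) total (λ { _ _ refl refl → refl }))
  where
  total : ∀ {x} → x ∈ downFrom X → ∃ λ c → c ∈ filter P? (allFin m) × x ≡ toℕ c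
  total x∈ = c , ∈-filter⁺ P? (∈-allFin c) (below c (subst (_< X) (sym c≡) x<X)) , sym c≡
    where
    x<X = ∈-downFrom⁻ x∈
    c = fromℕ< (ℕₚ.<-≤-trans x<X X≤m)
    c≡ = Finₚ.toℕ-fromℕ< (ℕₚ.<-≤-trans x<X X≤m)

♯-upper : ∀ {m X} {P : Fin m → Set} (P? : ∀ c → Dec (P c)) →
  (∀ c → P c → toℕ c < X) → ♯ P? (allFin m) ≤ X
♯-upper {m} {X} P? bound = subst (♯ P? (allFin m) ≤_) (length-downFrom X)
  (unique-length-≤ (λ c x → x ≡ toℕ c) (Unique.filter⁺ P? (Unique.allFin⁺ m))
    (λ {c} c∈ → toℕ c , ∈-downFrom⁺ (bound c (proj₂ (∈-filter⁻ P? {xs = allFin m} c∈))) , refl)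
    (λ _ _ e e′ → Finₚ.toℕ-injective (trans (sym e) e′)))

module _ {μ : Partition n} (T : RowStrictTableau μ) where
  open Partition μ
  open RowStrictTableau T

  entry-box : ∀ p → entry (box p) ≡ p
  entry-box p = Inverse.inverseˡ filling refl

  box-entry : ∀ b → box (entry b) ≡ b
  box-entry b = Inverse.inverseʳ filling refl

  entry-mono : ∀ r {c d : Fin (lookup parts r)} → toℕ c ≤ toℕ d → toℕ (entry (r , c)) ≤ toℕ (entry (r , d))
  entry-mono r {c} {d} c≤d with ℕₚ.m≤n⇒m<n∨m≡n c≤d
  ... | inj₁ c<d = ℕₚ.<⇒≤ (row-strict r c<d)
  ... | inj₂ c≡d = ℕₚ.≤-reflexive (cong (λ e → toℕ (entry (r , e))) (Finₚ.toℕ-injective c≡d))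

  -- A property instead of the function `content`, so that `dimensionPairs-rank` applies to a given
  -- tableau and also to the states from which a tableau is built.
  record Content (k : ℕ) (x : State) : Set where
    field
      fits  : ∀ r → x r ≤ lookup parts r
      early : ∀ {r} c → toℕ (entry (r , c)) < k → toℕ c < x r
      inner : ∀ {r} c → toℕ c < x r → toℕ (entry (r , c)) < k

  content : ℕ → State
  content k r = ♯ (λ c → toℕ (entry (r , c)) ℕₚ.<? k) (allFin (lookup parts r))

  content-content : ∀ k → Content k (content k)
  content-content k = record
    { fits  = λ r → ♯-upper (λ c → toℕ (entry (r , c)) ℕₚ.<? k) λ c _ → Finₚ.toℕ<n c
    ; early = λ {r} c e<k → ♯-lower (λ c → toℕ (entry (r , c)) ℕₚ.<? k) (Finₚ.toℕ<n c)
        λ c′ c′≤c → ℕₚ.≤-<-trans (entry-mono r (s≤s⁻¹ c′≤c)) e<k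
    ; inner = λ {r} c c<x → ℕₚ.≰⇒> λ k≤e → ℕₚ.<⇒≱ c<x
        (♯-upper (λ c → toℕ (entry (r , c)) ℕₚ.<? k)
          λ c′ e′<k → ℕₚ.≰⇒> λ c≤c′ → ℕₚ.<⇒≱ e′<k (ℕₚ.≤-trans k≤e (entry-mono r c≤c′)))
    }

  row-col-injective : ∀ {p p′} → row p ≡ row p′ → col p ≡ col p′ → p ≡ p′
  row-col-injective {p} {p′} r≡ c≡ = trans (sym (entry-box p)) (trans (cong entry (Σ-≡ r≡ c≡)) (entry-box p′))
    where
    Σ-≡ : ∀ {b b′ : Box} → proj₁ b ≡ proj₁ b′ → toℕ (proj₂ b) ≡ toℕ (proj₂ b′) → b ≡ b′
    Σ-≡ refl c≡ = cong (_ ,_) (Finₚ.toℕ-injective c≡)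

  module _ {q : Fin n} {x : State} (C : Content (suc (toℕ q)) x) where
    open Content C

    -- Condition (2) of a dimension pair makes `p` the last entry of its row among those up to `q`.
    last-in-row : ∀ p → toℕ p ≤ toℕ q →
      (∀ c → toℕ c ≡ suc (col p) → q Fin.< entry (row p , c)) → x (row p) ≡ suc (col p)
    last-in-row p p≤q next = ℕₚ.≤-antisym
      (ℕₚ.≮⇒≥ λ col<x →
        let col<λ = ℕₚ.<-≤-trans col<x (fits (row p))
            c  = fromℕ< col<λ
            c≡ = Finₚ.toℕ-fromℕ< col<λ
        in ℕₚ.<⇒≱ (inner c (ℕₚ.≤-trans (ℕₚ.≤-reflexive (cong suc c≡)) col<x)) (next c c≡))
      (early (proj₂ (box p)) (s≤s (subst (λ e → toℕ e ≤ toℕ q) (sym (entry-box p)) p≤q)))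

    x-row-q : x (row q) ≡ suc (col q)
    x-row-q = last-in-row q ℕₚ.≤-refl λ c c≡ → subst (Fin._< entry (row q , c)) (entry-box q)
      (row-strict (row q) (ℕₚ.≤-reflexive (sym c≡)))

    -- Each row ahead of that of `q` contributes exactly one `p`, its last entry up to `q`;
    -- condition (1) then becomes `Ahead`.
    dimensionPairs-rank : dimensionPairs T q ≡ rank x (row q)
    dimensionPairs-rank = ℕₚ.≤-antisym
      (♯-injection (λ p → dimensionPair? T p q) (ahead? x (row q)) (λ p r → r ≡ row p) (Unique.allFin⁺ n)
        (λ {p} _ d → row p , ∈-allFin (row p) , ahead p d , refl)
        (λ {p} {p′} _ _ (p<q , _ , next) (p′<q , _ , next′) r≡ r≡′ →
          let row≡ = trans (sym r≡) r≡′ in row-col-injective row≡ (ℕₚ.suc-injective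
            (trans (sym (last-in-row p (ℕₚ.<⇒≤ p<q) next))
              (trans (cong x row≡) (last-in-row p′ (ℕₚ.<⇒≤ p′<q) next′))))))
      (♯-injection (ahead? x (row q)) (λ p → dimensionPair? T p q) (λ r p → row p ≡ r)
        (Unique.allFin⁺ (length parts))
        (λ {r} _ a → let p , r≡ , d = pair r a in p , ∈-allFin p , d , r≡)
        (λ _ _ _ _ r≡ r≡′ → trans (sym r≡) r≡′))
      where
      ahead : ∀ p → DimensionPair T p q → Ahead x (row q) (row p)
      ahead p (p<q , pos , next) = cases pos
        where
        x-row-p = last-in-row p (ℕₚ.<⇒≤ p<q) next

        cases : _ → Ahead x (row q) (row p)
        cases (inj₁ (c≡ , r<)) = inj₁ (trans x-row-q (trans (cong suc c≡) (sym x-row-p)) , r<)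
        cases (inj₂ c<)        = inj₂ (subst₂ _<_ (sym x-row-q) (sym x-row-p) (s≤s c<))

      positive-ahead : ∀ {r} → Ahead x (row q) r → 0 < x r
      positive-ahead (inj₁ (e , _)) = subst (0 <_) (trans (sym x-row-q) e) z<s
      positive-ahead (inj₂ l)       = ℕₚ.≤-<-trans z≤n l

      pair : ∀ r → Ahead x (row q) r → ∃ λ p → row p ≡ r × DimensionPair T p q
      pair r a = p , row≡ , p<q , pos (subst (Ahead x (row q)) (sym row≡) a) , next
        where
        0<x : 0 < x r
        0<x = positive-ahead a

        x≡ : suc (pred (x r)) ≡ x r
        x≡ = ℕₚ.suc-pred (x r) ⦃ >-nonZero 0<x ⦄

        fit : pred (x r) < lookup parts r
        fit = ℕₚ.≤-trans (ℕₚ.≤-reflexive x≡) (fits r)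

        c : Fin (lookup parts r)
        c = fromℕ< fit

        p : Fin n
        p = entry (r , c)

        row≡ : row p ≡ r
        row≡ = cong proj₁ (box-entry (r , c))

        x-row-p : x (row p) ≡ suc (col p)
        x-row-p = trans (cong x row≡) (trans (sym x≡) (cong suc
          (sym (trans (cong (toℕ ∘ proj₂) (box-entry (r , c))) (Finₚ.toℕ-fromℕ< fit)))))

        p<q : p Fin.< q
        p<q = ℕₚ.≤∧≢⇒< (s≤s⁻¹ (inner c (ℕₚ.≤-reflexive (trans (cong suc (Finₚ.toℕ-fromℕ< fit)) x≡))))
          λ p≡q → ahead-irrefl x (row q) (subst (Ahead x (row q))
            (trans (sym row≡) (cong row (Finₚ.toℕ-injective p≡q))) a)

        next : ∀ c′ → toℕ c′ ≡ suc (col p) → q Fin.< entry (row p , c′)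
        next c′ c′≡ = ℕₚ.≰⇒> λ e≤q → ℕₚ.<-irrefl (trans c′≡ (sym x-row-p)) (early c′ (s≤s e≤q))

        pos : Ahead x (row q) (row p) → col q ≡ col p × row p Fin.< row q ⊎ col q < col p
        pos (inj₁ (e , l)) = inj₁ (ℕₚ.suc-injective (trans (sym x-row-q) (trans e x-row-p)) , l)
        pos (inj₂ l)       = inj₂ (s≤s⁻¹ (subst₂ _<_ x-row-q x-row-p l))

  content-step : ∀ q → Step (dimensionPairs T q) (content (suc (toℕ q))) (content (toℕ q))
  content-step q = record
    { row     = row q
    ; ranked  = sym (dimensionPairs-rank (content-content (suc (toℕ q))))
    ; removed = trans (x-row-q (content-content (suc (toℕ q)))) (cong suc (sym col-q))
    ; kept    = λ {r} r≢ → ♯-cong (λ c → toℕ (entry (r , c)) ℕₚ.<? toℕ q)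
        (λ c → toℕ (entry (r , c)) ℕₚ.<? suc (toℕ q)) (allFin (lookup parts r))
        (λ _ → ℕₚ.m<n⇒m<1+n)
        (λ {c} _ e≤q → ℕₚ.≤∧≢⇒< (s≤s⁻¹ e≤q) λ e≡q → r≢ (trans (sym (cong proj₁ (box-entry (r , c))))
          (cong row (Finₚ.toℕ-injective e≡q))))
    }
    where
    col-q : content (toℕ q) (row q) ≡ col q
    col-q = ℕₚ.≤-antisym
      (♯-upper (λ c → toℕ (entry (row q , c)) ℕₚ.<? toℕ q) λ c e<q → ℕₚ.≰⇒> λ col≤c →
        ℕₚ.<⇒≱ e<q (subst (λ e → toℕ e ≤ toℕ (entry (row q , c))) (entry-box q) (entry-mono (row q) col≤c)))
      (♯-lower (λ c → toℕ (entry (row q , c)) ℕₚ.<? toℕ q) (ℕₚ.<⇒≤ (Finₚ.toℕ<n (proj₂ (box q))))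
        λ c c<col → subst (λ e → toℕ (entry (row q , c)) < toℕ e) (entry-box q) (row-strict (row q) c<col))

  content-full : ∀ r → content n r ≡ lookup parts r
  content-full r = ℕₚ.≤-antisym
    (♯-upper (λ c → toℕ (entry (r , c)) ℕₚ.<? n) λ c _ → Finₚ.toℕ<n c)
    (♯-lower (λ c → toℕ (entry (r , c)) ℕₚ.<? n) ℕₚ.≤-refl λ c _ → Finₚ.toℕ<n (entry (r , c)))

  tableau-accept : ∀ {c : ℕ → ℕ} → (∀ q → c (toℕ q) ≡ dimensionPairs T q) → Accept c n (lookup parts)
  tableau-accept {c} c≡ = accept-⊴ n (≗⇒≼ (profile-cong content-full)) (λ _ → ℕₚ.≤-refl) (go n ℕₚ.≤-refl)
    where
    go : ∀ k → k ≤ n → Accept c k (content k)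
    go zero    _   = tt
    go (suc k) k<n = content k , subst₂ (λ k l → Step l (content (suc k)) (content k))
      (Finₚ.toℕ-fromℕ< k<n)
      (trans (sym (c≡ (fromℕ< k<n))) (cong c (Finₚ.toℕ-fromℕ< k<n)))
      (content-step (fromℕ< k<n)) , go k (ℕₚ.<⇒≤ k<n)

-- From accepted codes back to tableaux

accept-run : ∀ {R} {c : ℕ → ℕ} k {x : State {R}} → Accept c k x →
  ∃ λ (X : ℕ → State {R}) → X k ≡ x × (∀ {j} → j < k → Step (c j) (X (suc j)) (X j))
accept-run zero    {x} _ = (λ _ → x) , refl , λ ()
accept-run {R} {c} (suc k) {x} (y , s , ac) with accept-run k ac
... | X′ , refl , steps = X , high (ℕₚ.n<1+n k) , λ j<1+k → steps′ (ℕₚ.m≤n⇒m<n∨m≡n (s≤s⁻¹ j<1+k))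
  where
  X : ℕ → State {R}
  X j with j ℕₚ.≤? k
  ... | yes _ = X′ j
  ... | no  _ = x

  low : ∀ {j} → j ≤ k → X j ≡ X′ j
  low {j} j≤k with j ℕₚ.≤? k
  ... | yes _   = refl
  ... | no  j≰k = contradiction j≤k j≰k

  high : ∀ {j} → k < j → X j ≡ x
  high {j} k<j with j ℕₚ.≤? k
  ... | yes j≤k = contradiction k<j (ℕₚ.≤⇒≯ j≤k)
  ... | no  _   = refl

  steps′ : ∀ {j} → j < k ⊎ j ≡ k → Step (c j) (X (suc j)) (X j)
  steps′ (inj₁ j<k)  = subst₂ (Step (c _)) (sym (low j<k)) (sym (low (ℕₚ.<⇒≤ j<k))) (steps j<k)
  steps′ (inj₂ refl) = subst₂ (Step (c k)) (sym (high (ℕₚ.n<1+n k))) (sym (low ℕₚ.≤-refl)) s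

-- An injection of Fin n into the boxes is onto because the given tableau enumerates them by Fin n.
module Build {μ : Partition n} (T₀ : RowStrictTableau μ) {c : ℕ → ℕ}
  (X : ℕ → State {length (Partition.parts μ)})
  (X-full : X n ≡ lookup (Partition.parts μ))
  (steps : ∀ {j} → j < n → Step (c j) (X (suc j)) (X j)) where
  open Partition μ

  X-mono : ∀ {j} k → j ≤ k → k ≤ n → ∀ r → X j r ≤ X k r
  X-mono {j} k j≤k k≤n r with ℕₚ.m≤n⇒m<n∨m≡n j≤k
  ... | inj₂ refl = ℕₚ.≤-refl
  X-mono (suc k) _ k≤n r | inj₁ j<1+k =
    ℕₚ.≤-trans (X-mono k (s≤s⁻¹ j<1+k) (ℕₚ.<⇒≤ k≤n) r) (Step.kept-≤ (steps k≤n) r)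

  X-fits : ∀ {k} → k ≤ n → ∀ r → X k r ≤ lookup parts r
  X-fits k≤n r = subst (λ x → X _ r ≤ x r) X-full (X-mono n k≤n ℕₚ.≤-refl r)

  ρ : Fin n → Fin (length parts)
  ρ q = Step.row (steps (Finₚ.toℕ<n q))

  -- The length left after the removal is the column, counted from 0, of the removed box, which is
  -- to hold `q`.
  κ : Fin n → ℕ
  κ q = X (toℕ q) (ρ q)

  κ-removed : ∀ q → X (suc (toℕ q)) (ρ q) ≡ suc (κ q)
  κ-removed q = Step.removed (steps (Finₚ.toℕ<n q))

  κ-fits : ∀ q → κ q < lookup parts (ρ q)
  κ-fits q = ℕₚ.≤-trans (ℕₚ.≤-reflexive (sym (κ-removed q))) (X-fits (Finₚ.toℕ<n q) (ρ q))

  κ-mono : ∀ {q q′} → q Fin.< q′ → ρ q ≡ ρ q′ → κ q < κ q′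
  κ-mono {q} {q′} q<q′ ρ≡ = ℕₚ.≤-trans (ℕₚ.≤-reflexive (sym (κ-removed q)))
    (ℕₚ.≤-trans (X-mono (toℕ q′) q<q′ (ℕₚ.<⇒≤ (Finₚ.toℕ<n q′)) (ρ q)) (ℕₚ.≤-reflexive (cong (X (toℕ q′)) ρ≡)))

  place : Fin n → Box
  place q = ρ q , fromℕ< (κ-fits q)

  place-κ : ∀ {q b} → place q ≡ b → κ q ≡ toℕ (proj₂ b)
  place-κ {q} refl = sym (Finₚ.toℕ-fromℕ< (κ-fits q))

  place-injective : ∀ {q q′} → place q ≡ place q′ → q ≡ q′
  place-injective {q} {q′} eq with Finₚ.<-cmp q q′
  ... | tri< q<q′ _ _ = contradiction κ≡ (ℕₚ.<⇒≢ (κ-mono q<q′ (cong proj₁ eq)))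
    where κ≡ = trans (place-κ eq) (sym (place-κ refl))
  ... | tri≈ _ q≡q′ _ = q≡q′
  ... | tri> _ _ q′<q = contradiction (sym κ≡) (ℕₚ.<⇒≢ (κ-mono q′<q (cong proj₁ (sym eq))))
    where κ≡ = trans (place-κ eq) (sym (place-κ refl))

  entry₀-injective : ∀ {b b′} → RowStrictTableau.entry T₀ b ≡ RowStrictTableau.entry T₀ b′ → b ≡ b′
  entry₀-injective {b} {b′} eq =
    trans (sym (box-entry T₀ b)) (trans (cong (RowStrictTableau.box T₀) eq) (box-entry T₀ b′))

  hit : ∀ b → ∃ λ q → RowStrictTableau.entry T₀ (place q) ≡ RowStrictTableau.entry T₀ b
  hit b = injective⇒hits (place-injective ∘ entry₀-injective) (RowStrictTableau.entry T₀ b)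

  at : Box → Fin n
  at b = proj₁ (hit b)

  place-at : ∀ b → place (at b) ≡ b
  place-at b = entry₀-injective (proj₂ (hit b))

  tableau : RowStrictTableau μ
  tableau = record
    { filling    = mk↔ₛ′ at place (λ q → place-injective (place-at (place q))) place-at
    ; row-strict = λ r {c} {d} c<d → ℕₚ.≰⇒> λ d≤c → row-strict′ r c<d (ℕₚ.m≤n⇒m<n∨m≡n d≤c)
    }
    where
    row-strict′ : ∀ r {c d : Fin (lookup parts r)} → c Fin.< d →
      ¬ (at (r , d) Fin.< at (r , c) ⊎ toℕ (at (r , d)) ≡ toℕ (at (r , c)))
    row-strict′ r {c} {d} c<d (inj₁ l) = ℕₚ.<-asym c<d (subst₂ _<_
      (place-κ (place-at (r , d))) (place-κ (place-at (r , c)))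
      (κ-mono l (trans (cong proj₁ (place-at (r , d))) (sym (cong proj₁ (place-at (r , c)))))))
    row-strict′ r {c} {d} c<d (inj₂ e) = ℕₚ.<⇒≢ c<d (trans (sym (place-κ (place-at (r , c))))
      (trans (cong κ (sym (Finₚ.toℕ-injective e))) (place-κ (place-at (r , d)))))

  X-content : ∀ {k} → k ≤ n → Content tableau k (X k)
  X-content {k} k≤n = record
    { fits  = X-fits k≤n
    ; early = λ {r} c e<k → let q = at (r , c) ; q≡ = place-at (r , c) in
        subst₂ _≤_ (trans (κ-removed q) (cong suc (place-κ q≡))) (cong (X k) (cong proj₁ q≡))
          (X-mono k e<k k≤n (ρ q))
    ; inner = λ {r} c c<x → ℕₚ.≰⇒> λ k≤e → let q = at (r , c) ; q≡ = place-at (r , c) in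
        ℕₚ.<⇒≱ c<x (subst₂ _≤_ (cong (X k) (cong proj₁ q≡)) (place-κ q≡)
          (X-mono (toℕ q) k≤e (ℕₚ.<⇒≤ (Finₚ.toℕ<n q)) (ρ q)))
    }

  dimensionPairs-tableau : ∀ q → dimensionPairs tableau q ≡ c (toℕ q)
  dimensionPairs-tableau q = trans (dimensionPairs-rank tableau (X-content (Finₚ.toℕ<n q)))
    (Step.ranked (steps (Finₚ.toℕ<n q)))

schubert⇒accept : ∀ {μ : Partition n} {w} → IsSchubertPoint μ w →
  Accept (code (line w)) n (lookup (Partition.parts μ))
schubert⇒accept {w = w} (T , w≈) = tableau-accept T λ q →
  trans (code-cong (line-cong {v = w} {schubertPoint T} w≈) (toℕ q)) (code-schubertPoint T q)

-- The accepted run yields a tableau whose Schubert point has the code of `v`, and codes determine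
-- permutations.
accept⇒schubert : ∀ {μ : Partition n} {v} → RowStrictTableau μ →
  Accept (code (line v)) n (lookup (Partition.parts μ)) → IsSchubertPoint μ v
accept⇒schubert {n} {v = v} T₀ ac with accept-run n ac
... | X , X-full , steps = tableau , code-injective v (schubertPoint tableau) λ {q} q<n → same (view n q) q<n
  where
  open Build T₀ X X-full steps

  same : ∀ {q} → View n q → q < n → code (line v) q ≡ code (line (schubertPoint tableau)) q
  same (inside i)    _   = sym (trans (code-schubertPoint tableau i) (dimensionPairs-tableau i))
  same (outside n≤q) q<n = contradiction q<n (ℕₚ.≤⇒≯ n≤q)

linked-head : ∀ {m ms} → Linked _≥_ (m ∷ ms) → ∀ r → lookup (m ∷ ms) r ≤ m
linked-head _         zero    = ℕₚ.≤-refl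
linked-head (m≥ ∷ ms) (suc r) = ℕₚ.≤-trans (linked-head ms r) m≥

parts-≤-columns : ∀ (μ : Partition n) r → lookup (Partition.parts μ) r ≤ Partition.columns μ
parts-≤-columns record { parts = _ ∷ _ ; decreasing = d } = linked-head d

shape : ∀ (μ : Partition n) → Partition.rows μ ≤ 3 ⊎ Partition.columns μ ≤ 2 →
  Shape (lookup (Partition.parts μ))
shape μ (inj₁ rows≤3)    = inj₁ (ℕₚ.≤-trans (profile-≤ (lookup (Partition.parts μ)) 0) rows≤3)
shape μ (inj₂ columns≤2) = inj₂ (profile-zero λ r → ℕₚ.≤-trans (parts-≤-columns μ r) columns≤2)

theorem4p4 :
    (n : ℕ) (μ : Partition n) →
    (Partition.rows μ ≤ 3) ⊎ (Partition.columns μ ≤ 2) →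
    (v w : Permutation′ n) →
    IsSchubertPoint μ w → v ≤ᴮ w → IsSchubertPoint μ v
theorem4p4 n μ small v w w-point v≤w = accept⇒schubert (proj₁ w-point)
  (bruhat-accept (shape μ small) v≤w (schubert⇒accept w-point))
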